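{- Let $(P,e)$, $P\in\mathcal{T}_k$, be a staggered tree pattern with signature $(\alpha_1,\dots,\alpha_\ell;\beta_1,\dots,\beta_{\ell-1})$ satisfying: (i) if $\ell>1$ and $\beta_1=\alpha_1$, then $\alpha_1\in\{1,2\}$; (ii) $\beta_i<\alpha_i$ for all $i=2,\dots,\ell-1$. Then for every $n\ge0$ the map $\varphi_L\colon\mathcal{T}_n(P,e)\to\mathcal{P}_n(1212,\varphi_L(P))$ is a bijection.
   Context: $\mathcal{T}_n$ is the set of binary trees on $n$ vertices labeled $1,\dots,n$ by the search tree property; $c_L,c_R,p$ are left child, right child, parent; $r(P)$ root; $P(j)$ the subtree rooted at $j$. A tree pattern is $(P,e)$, $P\in\mathcal{T}_k$, $e\colon[k]\setminus\{r(P)\}\to\{0,1\}$ ($e(i)=1$: edge to parent contiguous, $e(i)=0$: non-contiguous); $e_{P(j)}$ is the restriction of $e$ to the non-root vertices of $P(j)$. $T\in\mathcal{T}_n$ contains $(P,e)$ if there is an injection $f\colon[k]\to[n]$ such that for each non-root $i$ of $P$: if $e(i)=1$, $f(i)$ is the left (resp. right) child of $f(p(i))$ when $i$ is the left (resp. right) child of $p(i)$; if $e(i)=0$, $f(i)$ lies in the left (resp. right) subtree of $f(p(i))$. $\mathcal{T}_n(P,e)$ is the set of avoiders. Staggered patterns (recursive): $(P,e)$ is staggered if either $P$ is a left path (no vertex has a right child) with all edges contiguous, or the left branch $r(P),c_L(r(P)),c_L^2(r(P)),\dots$ starting at the root has all edges contiguous, exactly one vertex $i$ on this branch has a right child $j=c_R(i)$,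 $e(j)=0$, and $(P(j),e_{P(j)})$ is staggered. Its signature $(\alpha_1,\dots,\alpha_\ell;\beta_1,\dots,\beta_{\ell-1})$: the pattern decomposes into $\ell$ contiguous left branches (the first starting at the root, the $(m+1)$-st starting at the right child of the distinguished vertex of the $m$-th); $\alpha_m$ is the number of vertices of the $m$-th branch, and the distinguished vertex (having a right child) of the $m$-th branch, $m<\ell$, is the $\beta_m$-th vertex counted from bottom to top. For a binary tree $T$ on $[n]$, $\varphi_L(T)$ is the set partition of $[n]$ into vertex sets of the maximal left branches of $T$ (maximal sequences $v,c_L(v),c_L^2(v),\dots$), written as its restricted growth string (RGS): order blocks by smallest element, $x_i=j$ if $i$ is in the $j$-th block. $\mathcal{P}_n$ is the set of RGS of length $n$. A string $x$ contains a pattern string $\tau_1\cdots\tau_m$ if there are $i_1<\dots<i_m$ with $x_{i_a}<x_{i_b}\iff\tau_a<\tau_b$ and $x_{i_a}=x_{i_b}\iff\tau_a=\tau_b$; $\mathcal{P}_n(1212,\varphi_L(P))$ is the set of RGS avoiding both $1212$ and the string $\varphi_L(P)$. -}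

module Defs where

open import Data.Bool using (if_then_else_)
open import Data.Fin as Fin using (Fin)
import Data.Fin.Properties as Fin
open import Data.List using (List; []; _∷_; _++_; length)
open import Data.List.Membership.DecPropositional using (_∈?_)
open import Data.List.Membership.Propositional using (_∈_)
import Data.List.Extrema as Extrema
open import Data.List.NonEmpty as List⁺ using (List⁺; _∷_)
open import Data.List.Relation.Unary.AllPairs using (AllPairs)
open import Data.List.Relation.Unary.Any using (Any)
import Data.List.Sort as Sort
open import Data.Nat as ℕ using (ℕ; suc)
open import Data.Product using (Σ-syntax; ∃; ∃-syntax; ∃₂; _×_; _,_; proj₁)
open import Data.Sum using (_⊎_; inj₁; inj₂)
open import Data.Vec using (Vec; []; _∷_; lookup; tabulate)
open import Function using (_on_; _⇔_)
open import Function.Definitions using (Injective; Bijective)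
open import Level using (Level; 0ℓ; _⊔_)
import Relation.Binary.Construct.On as On
open import Relation.Binary.PropositionalEquality using (_≡_)
open import Relation.Nullary using (¬_; does)
open import Relation.Unary using (Pred)

-- The label set [n] is Fin n, so labels are 0-based.
data Tree (A : Set) : Set where
  nil  : Tree A
  node : (l : Tree A) (x : A) (r : Tree A) → Tree A

infix 4 _⊑_ _⊑ˡ_ _∈ᵗ_

data _⊑_ {A : Set} (s : Tree A) : Tree A → Set where
  here  : s ⊑ s
  left  : ∀ {l x r} → s ⊑ l → s ⊑ node l x r
  right : ∀ {l x r} → s ⊑ r → s ⊑ node l x r

-- s is the subtree at a vertex of the left branch of t starting at the
-- root (or the empty tree at the end of that branch).
data _⊑ˡ_ {A : Set} (s : Tree A) : Tree A → Set where
  here : s ⊑ˡ s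
  left : ∀ {l x r} → s ⊑ˡ l → s ⊑ˡ node l x r

⊑ˡ⇒⊑ : {A : Set} {s t : Tree A} → s ⊑ˡ t → s ⊑ t
⊑ˡ⇒⊑ here     = here
⊑ˡ⇒⊑ (left p) = left (⊑ˡ⇒⊑ p)

⊑-trans : {A : Set} {s t u : Tree A} → s ⊑ t → t ⊑ u → s ⊑ u
⊑-trans p here      = p
⊑-trans p (left q)  = left (⊑-trans p q)
⊑-trans p (right q) = right (⊑-trans p q)

_∈ᵗ_ : {A : Set} → A → Tree A → Set
i ∈ᵗ t = ∃₂ λ l r → node l i r ⊑ t

module _ {A : Set} (t : Tree A) where

  -- The second argument is the parent (resp. ancestor), the third the
  -- child (resp. descendant).

  LeftChild : A → A → Set
  LeftChild p i = ∃₂ λ a b → ∃[ r ] node (node a i b) p r ⊑ t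

  RightChild : A → A → Set
  RightChild p i = ∃[ l ] ∃₂ λ a b → node l p (node a i b) ⊑ t

  InLeftSubtree : A → A → Set
  InLeftSubtree p i = ∃₂ λ l r → node l p r ⊑ t × i ∈ᵗ l

  InRightSubtree : A → A → Set
  InRightSubtree p i = ∃₂ λ l r → node l p r ⊑ t × i ∈ᵗ r

  NonRoot : A → Set
  NonRoot i = ∃[ p ] (LeftChild p i ⊎ RightChild p i)

SearchTree : ∀ {n} → Pred (Tree (Fin n)) 0ℓ
SearchTree t = (∀ i j → InLeftSubtree t i j → j Fin.< i)
             × (∀ i j → InRightSubtree t i j → i Fin.< j)

-- The search tree property makes the labels distinct, so a member of
-- 𝒯 n has exactly n vertices.
𝒯 : ∀ n → Pred (Tree (Fin n)) 0ℓ
𝒯 n t = SearchTree t × (∀ i → i ∈ᵗ t)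

data EdgeKind : Set where
  contiguous noncontiguous : EdgeKind

EdgeLabelling : {A : Set} → Tree A → Set
EdgeLabelling {A} t = (i : A) → .(NonRoot t i) → EdgeKind

NonRoot-mono : {A : Set} {s t : Tree A} {i : A} → s ⊑ t → NonRoot s i → NonRoot t i
NonRoot-mono s⊑t (p , inj₁ (a , b , r , q)) = p , inj₁ (a , b , r , ⊑-trans q s⊑t)
NonRoot-mono s⊑t (p , inj₂ (l , a , b , q)) = p , inj₂ (l , a , b , ⊑-trans q s⊑t)

restrict : {A : Set} {s t : Tree A} → s ⊑ t → EdgeLabelling t → EdgeLabelling s
restrict s⊑t e i q = e i (NonRoot-mono s⊑t q)

LeftRelation RightRelation : {A : Set} → EdgeKind → Tree A → A → A → Set
LeftRelation contiguous     = LeftChild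
LeftRelation noncontiguous  = InLeftSubtree
RightRelation contiguous    = RightChild
RightRelation noncontiguous = InRightSubtree

record Contains {n k} (T : Tree (Fin n)) (P : Tree (Fin k)) (e : EdgeLabelling P) : Set where
  field
    f           : Fin k → Fin n
    f-injective : Injective _≡_ _≡_ f
    f-left      : ∀ p i (c : LeftChild P p i) →
                  LeftRelation (e i (p , inj₁ c)) T (f p) (f i)
    f-right     : ∀ p i (c : RightChild P p i) →
                  RightRelation (e i (p , inj₂ c)) T (f p) (f i)

𝒯-avoiding : ∀ n {k} (P : Tree (Fin k)) → EdgeLabelling P → Pred (Tree (Fin n)) 0ℓ
𝒯-avoiding n P e T = 𝒯 n T × ¬ Contains T P e

-- The sequence v, c_L(v), c_L²(v), … for the root v.
leftBranch : {A : Set} → Tree A → List A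
leftBranch nil          = []
leftBranch (node l x r) = x ∷ leftBranch l

LeftBranchContiguous : {A : Set} (t : Tree A) → EdgeLabelling t → Set
LeftBranchContiguous t e = ∀ {a i b p r} (q : node (node a i b) p r ⊑ˡ t) →
  e i (p , inj₁ (a , b , r , ⊑ˡ⇒⊑ q)) ≡ contiguous

data Staggered {A : Set} : (t : Tree A) → EdgeLabelling t → Set where

  leftPath : ∀ {l x r} {e : EdgeLabelling (node l x r)} →
    (∀ i j → ¬ RightChild (node l x r) i j) →
    (∀ i (q : NonRoot (node l x r) i) → e i q ≡ contiguous) →
    Staggered (node l x r) e

  -- node l i (node a j b) is P(i), and node a j b is P(j).
  branching : ∀ {t : Tree A} {e : EdgeLabelling t} →
    LeftBranchContiguous t e →
    ∀ {l i a j b} (q : node l i (node a j b) ⊑ˡ t) →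
    (∀ {l′ i′ a′ j′ b′} → node l′ i′ (node a′ j′ b′) ⊑ˡ t → i′ ≡ i) →
    e j (i , inj₂ (l , a , b , ⊑ˡ⇒⊑ q)) ≡ noncontiguous →
    Staggered (node a j b) (restrict (⊑-trans (right here) (⊑ˡ⇒⊑ q)) e) →
    Staggered t e

record Signature : Set where
  constructor mkSignature
  field
    {ℓ∸1} : ℕ
    α     : Vec ℕ (suc ℓ∸1)
    β     : Vec ℕ ℓ∸1

-- The position of i on the left branch, counted from the bottom and
-- starting at 1, is the number of vertices on the left branch of P(i).
signature : {A : Set} {t : Tree A} {e : EdgeLabelling t} → Staggered t e → Signature
signature {t = t} (leftPath _ _) = mkSignature (length (leftBranch t) ∷ []) []
signature {t = t} (branching _ {l} {i} {a} {j} {b} _ _ _ s) =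
  mkSignature (length (leftBranch t) ∷ α) (length (leftBranch (node l i (node a j b))) ∷ β)
  where open Signature (signature s)

-- A block is the set of entries of a nonempty list; the order and
-- multiplicity of the entries are immaterial.
Block : ℕ → Set
Block n = List⁺ (Fin n)

smallest : ∀ {n} → Block n → Fin n
smallest {n} (x ∷ xs) = Extrema.min (Fin.≤-totalOrder n) x xs

sortBlocks : ∀ {n} → List (Block n) → List (Block n)
sortBlocks {n} = Sort.sort (On.decTotalOrder (Fin.≤-decTotalOrder n) smallest)

-- The 1-based position of the first block containing i; the value in
-- the case that no block contains i is irrelevant.
blockIndex : ∀ {n} → Fin n → List (Block n) → ℕ
blockIndex i []       = 0
blockIndex i (B ∷ Bs) = if does (_∈?_ Fin._≟_ i (List⁺.toList B)) then 1 else suc (blockIndex i Bs)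

rgs : ∀ {n} → List (Block n) → Vec ℕ n
rgs Bs = tabulate λ i → blockIndex i (sortBlocks Bs)

IsSetPartition : ∀ {n} → Pred (List (Block n)) 0ℓ
IsSetPartition Bs = (∀ i → Any (λ B → i ∈ List⁺.toList B) Bs)
                  × AllPairs (λ B C → ∀ i → ¬ (i ∈ List⁺.toList B × i ∈ List⁺.toList C)) Bs

𝒫 : ∀ n → Pred (Vec ℕ n) 0ℓ
𝒫 n x = ∃[ Bs ] IsSetPartition Bs × rgs Bs ≡ x

StringContains : ∀ {n m} → Vec ℕ n → Vec ℕ m → Set
StringContains {n} {m} x τ = Σ[ ι ∈ (Fin m → Fin n) ]
    (∀ a b → a Fin.< b → ι a Fin.< ι b)
  × (∀ a b → (lookup x (ι a) ℕ.< lookup x (ι b)) ⇔ (lookup τ a ℕ.< lookup τ b))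
  × (∀ a b → (lookup x (ι a) ≡ lookup x (ι b)) ⇔ (lookup τ a ≡ lookup τ b))

𝒫-avoiding : ∀ n {m k} → Vec ℕ m → Vec ℕ k → Pred (Vec ℕ n) 0ℓ
𝒫-avoiding n σ τ x = 𝒫 n x × ¬ StringContains x σ × ¬ StringContains x τ

-- A maximal left branch starts at the root or at a right child;
-- lowerBranches collects those starting at a right child.
mutual
  maximalLeftBranches : ∀ {n} → Tree (Fin n) → List (Block n)
  maximalLeftBranches nil            = []
  maximalLeftBranches t@(node l x r) = (x ∷ leftBranch l) ∷ lowerBranches t

  lowerBranches : ∀ {n} → Tree (Fin n) → List (Block n)
  lowerBranches nil          = []
  lowerBranches (node l x r) = lowerBranches l ++ maximalLeftBranches r

φL : ∀ {n} → Tree (Fin n) → Vec ℕ n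
φL t = rgs (maximalLeftBranches t)

-- f restricts to a bijection from the subset X to the subset Y.  Elements
-- of a subset are compared by their underlying elements only.
BijectionBetween : ∀ {a b p q : Level} {A : Set a} {B : Set b} →
  (A → B) → Pred A p → Pred B q → Set (a ⊔ b ⊔ p ⊔ q)
BijectionBetween f X Y = Σ[ maps ∈ (∀ x → X x → Y (f x)) ]
  Bijective {A = ∃ X} {B = ∃ Y} (_≡_ on proj₁) (_≡_ on proj₁)
    (λ (x , x∈X) → f x , maps x x∈X)

{-# OPTIONS --safe #-}

-- φL T determines T and every noncrossing partition arises: the root of T is the largest
-- element in the block of the smallest label, so T is recovered recursively.  A staggered
-- pattern has contiguous left and noncontiguous right edges only, and its branches form a
-- chain, so an occurrence in T is order preserving and yields an occurrence of φL P in φL T.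
-- Conversely, an occurrence of φL P in φL T selects one block B_m of T for each branch of P.
-- If β_m < α_m, the noncrossing property places B_{m+1} between two consecutive elements of
-- B_m, i.e. in the right subtree of one vertex of B_m with enough vertices of B_m on both
-- sides.  If β_1 = α_1 ≤ 2, the block B_2 need not lie below B_1; but B_2 does not contain
-- the root, and it lies in the right subtree of some vertex (having a left child if α_1 = 2).
module Submission where

open import Defs
open import Data.Bool using (if_then_else_)
open import Data.Empty using (⊥-elim)
open import Data.Fin as Fin using (Fin; zero; suc; toℕ; inject₁)
open import Data.Fin.Induction using (<-wellFounded)
import Data.Fin.Properties as Fin
open import Data.List using (List; []; _∷_; length)
import Data.List.Extrema as Extrema
open import Data.List.Membership.DecPropositional using (_∈?_)
open import Data.List.Membership.Propositional using (_∈_)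
open import Data.List.NonEmpty as List⁺ using (_∷_)
open import Data.List.Relation.Binary.Permutation.Propositional using (↭-sym; ↭⇒↭ₛ)
open import Data.List.Relation.Binary.Permutation.Propositional.Properties using (Any-resp-↭)
import Data.List.Relation.Binary.Permutation.Setoid.Properties as Permutation
open import Data.List.Relation.Unary.All as All using (All; []; _∷_)
import Data.List.Relation.Unary.All.Properties as All
open import Data.List.Relation.Unary.AllPairs using (AllPairs; []; _∷_)
import Data.List.Relation.Unary.AllPairs.Properties as AllPairs
open import Data.List.Relation.Unary.Any as Any using (Any; here; there)
import Data.List.Relation.Unary.Any.Properties as Any
open import Data.List.Relation.Unary.Sorted.TotalOrder.Properties using (Sorted⇒AllPairs)
import Data.List.Sort as Sort
open import Data.Nat as ℕ using (ℕ; s≤s; z≤n; _<_; _≤_)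
import Data.Nat.Properties as ℕ
open import Data.Product using (∃; ∃-syntax; ∃₂; _×_; _,_; proj₁; proj₂)
open import Data.Sum as Sum using (_⊎_; inj₁; inj₂)
open import Data.Vec using (Vec; []; _∷_; lookup)
open import Data.Vec.Properties using (lookup∘tabulate; tabulate∘lookup; tabulate-cong)
open import Function using (_⇔_; mk⇔; Equivalence)
open import Induction.WellFounded using (Acc; acc)
open import Level using (0ℓ)
open import Relation.Binary using (tri<; tri≈; tri>; DecTotalOrder)
import Relation.Binary.Construct.On as On
open import Relation.Binary.PropositionalEquality using (_≡_; _≢_; refl; sym; trans; cong; cong₂; subst; subst₂; setoid)
open import Relation.Nullary using (¬_; Dec; yes; no)
open import Relation.Nullary.Decidable using (dec-true; dec-false)
open import Relation.Unary using (Pred; Decidable)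

-- The letters of `φL` are never computed. Equality of letters is membership in one branch
-- (`φL-kernel`), and their order enters only through restricted growth: every smaller letter has
-- already occurred earlier. The obstacle in passing from strings to trees is contiguity. The
-- positions `ι` of a string occurrence may skip vertices of a block, whereas a left edge must join
-- a vertex to its child, so `ι` itself is in general no occurrence in the tree and a new one has to
-- be built. A contiguous piece of a branch is governed only by how many vertices it has; hence the
-- pieces above and below a branching vertex can be slid towards it until all gaps close. `Match`
-- records the resulting alignment of shapes, and the map on labels is read off from it afterwards.
-- If the root of the pattern has a right child, the position of the second block is controlled only
-- by the order of letters. That argument supplies a vertex with at most one guaranteed left child,
-- whence the bound 2 in condition (i).

private variable
  n k : ℕ
  A B : Set

-- Left branches in search trees

infix 4 _∈ˡ_

_∈ˡ_ : A → Tree A → Set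
i ∈ˡ t = ∃₂ λ l r → node l i r ⊑ˡ t

SameBranch : Tree A → A → A → Set
SameBranch t i j = ∃[ s ] s ⊑ t × i ∈ˡ s × j ∈ˡ s

⊑ˡ-trans : {s t u : Tree A} → s ⊑ˡ t → t ⊑ˡ u → s ⊑ˡ u
⊑ˡ-trans p here     = p
⊑ˡ-trans p (left q) = left (⊑ˡ-trans p q)

∈ᵗ-mono : {s t : Tree A} {i : A} → s ⊑ t → i ∈ᵗ s → i ∈ᵗ t
∈ᵗ-mono s⊑t (l , r , q) = l , r , ⊑-trans q s⊑t

∈ˡ-mono : {s t : Tree A} {i : A} → s ⊑ˡ t → i ∈ˡ s → i ∈ˡ t
∈ˡ-mono s⊑t (l , r , q) = l , r , ⊑ˡ-trans q s⊑t

∈ˡ⇒∈ᵗ : {t : Tree A} {i : A} → i ∈ˡ t → i ∈ᵗ t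
∈ˡ⇒∈ᵗ (l , r , q) = l , r , ⊑ˡ⇒⊑ q

SameBranch-mono : {s t : Tree A} {i j : A} → s ⊑ t → SameBranch s i j → SameBranch t i j
SameBranch-mono s⊑t (u , u⊑s , p) = u , ⊑-trans u⊑s s⊑t , p

SameBranch-sym : {t : Tree A} {i j : A} → SameBranch t i j → SameBranch t j i
SameBranch-sym (s , s⊑t , i∈s , j∈s) = s , s⊑t , j∈s , i∈s

InRightSubtree-mono : {s t : Tree A} {i j : A} → s ⊑ t → InRightSubtree s i j → InRightSubtree t i j
InRightSubtree-mono s⊑t (l , r , q , j∈r) = l , r , ⊑-trans q s⊑t , j∈r

root∈ᵗ : {l r : Tree A} {x : A} → x ∈ᵗ node l x r
root∈ᵗ = _ , _ , here

∈ᵗ-split : {l r : Tree A} {x i : A} → i ∈ᵗ node l x r → i ∈ᵗ l ⊎ i ≡ x ⊎ i ∈ᵗ r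
∈ᵗ-split (_ , _ , here)    = inj₂ (inj₁ refl)
∈ᵗ-split (_ , _ , left q)  = inj₁ (_ , _ , q)
∈ᵗ-split (_ , _ , right q) = inj₂ (inj₂ (_ , _ , q))

∈ˡ-split : {l r : Tree A} {x i : A} → i ∈ˡ node l x r → i ≡ x ⊎ i ∈ˡ l
∈ˡ-split (_ , _ , here)   = inj₁ refl
∈ˡ-split (_ , _ , left q) = inj₂ (_ , _ , q)

-- Cuts a tree into its root branch and the right subtrees hanging from it. `Staggered` recurses
-- along the same decomposition, so patterns and branches are analysed by this split.
⊑-split : {s t : Tree A} → s ⊑ t → s ⊑ˡ t ⊎ ∃[ l ] ∃₂ λ u r → node l u r ⊑ˡ t × s ⊑ r
⊑-split here      = inj₁ here
⊑-split (left q) with ⊑-split q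
... | inj₁ p                   = inj₁ (left p)
... | inj₂ (l , u , r , p , p′) = inj₂ (l , u , r , left p , p′)
⊑-split (right q) = inj₂ (_ , _ , _ , here , q)

∈ᵗ-branch : {t : Tree A} {i : A} → i ∈ᵗ t → i ∈ˡ t ⊎ ∃[ l ] ∃₂ λ u r → node l u r ⊑ˡ t × i ∈ᵗ r
∈ᵗ-branch (l , r , q) with ⊑-split q
... | inj₁ p                     = inj₁ (l , r , p)
... | inj₂ (l′ , u , r′ , p , p′) = inj₂ (l′ , u , r′ , p , l , r , p′)

⊑ˡ-parent : {s l r : Tree A} {x : A} → s ⊑ˡ l → ∃₂ λ y r′ → node s y r′ ⊑ˡ node l x r
⊑ˡ-parent here     = _ , _ , here
⊑ˡ-parent (left q) with ⊑ˡ-parent q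
... | y , r′ , p = y , r′ , left p

SearchTree-⊑ : {s t : Tree (Fin n)} → s ⊑ t → SearchTree t → SearchTree s
SearchTree-⊑ s⊑t (L , R) =
  (λ i j (l , r , q , p) → L i j (l , r , ⊑-trans q s⊑t , p)) ,
  (λ i j (l , r , q , p) → R i j (l , r , ⊑-trans q s⊑t , p))

module _ {l r : Tree (Fin n)} {x : Fin n} (st : SearchTree (node l x r)) where

  SearchTree-left : SearchTree l
  SearchTree-left = SearchTree-⊑ (left here) st

  SearchTree-right : SearchTree r
  SearchTree-right = SearchTree-⊑ (right here) st

  left< : ∀ {i} → i ∈ᵗ l → i Fin.< x
  left< i∈l = proj₁ st _ _ (_ , _ , here , i∈l)

  right> : ∀ {i} → i ∈ᵗ r → x Fin.< i
  right> i∈r = proj₂ st _ _ (_ , _ , here , i∈r)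

  ∈-left : ∀ {i} → i ∈ᵗ node l x r → i Fin.< x → i ∈ᵗ l
  ∈-left i∈t i<x with ∈ᵗ-split i∈t
  ... | inj₁ i∈l        = i∈l
  ... | inj₂ (inj₁ refl) = ⊥-elim (Fin.<-irrefl refl i<x)
  ... | inj₂ (inj₂ i∈r)  = ⊥-elim (Fin.<-asym i<x (right> i∈r))

  ∈-right : ∀ {i} → i ∈ᵗ node l x r → x Fin.< i → i ∈ᵗ r
  ∈-right i∈t x<i with ∈ᵗ-split i∈t
  ... | inj₁ i∈l        = ⊥-elim (Fin.<-asym x<i (left< i∈l))
  ... | inj₂ (inj₁ refl) = ⊥-elim (Fin.<-irrefl refl x<i)
  ... | inj₂ (inj₂ i∈r)  = i∈r

  ∈ˡ⇒≤root : ∀ {i} → i ∈ˡ node l x r → i Fin.≤ x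
  ∈ˡ⇒≤root i∈t with ∈ˡ-split i∈t
  ... | inj₁ refl = ℕ.≤-refl
  ... | inj₂ i∈l  = ℕ.<⇒≤ (left< (∈ˡ⇒∈ᵗ i∈l))

  ∈ˡ-left : ∀ {i} → i ∈ˡ node l x r → i Fin.< x → i ∈ˡ l
  ∈ˡ-left i∈t i<x with ∈ˡ-split i∈t
  ... | inj₁ refl = ⊥-elim (Fin.<-irrefl refl i<x)
  ... | inj₂ i∈l  = i∈l

node-unique : {t l r l′ r′ : Tree (Fin n)} {x : Fin n} → SearchTree t →
  node l x r ⊑ t → node l′ x r′ ⊑ t → l ≡ l′ × r ≡ r′
node-unique st here here            = refl , refl
node-unique st here (left q)        = ⊥-elim (Fin.<-irrefl refl (left< st (_ , _ , q)))
node-unique st here (right q)       = ⊥-elim (Fin.<-irrefl refl (right> st (_ , _ , q)))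
node-unique st (left p) here        = ⊥-elim (Fin.<-irrefl refl (left< st (_ , _ , p)))
node-unique st (left p) (left q)    = node-unique (SearchTree-left st) p q
node-unique st (left p) (right q)   = ⊥-elim (Fin.<-asym (left< st (_ , _ , p)) (right> st (_ , _ , q)))
node-unique st (right p) here       = ⊥-elim (Fin.<-irrefl refl (right> st (_ , _ , p)))
node-unique st (right p) (left q)   = ⊥-elim (Fin.<-asym (left< st (_ , _ , q)) (right> st (_ , _ , p)))
node-unique st (right p) (right q)  = node-unique (SearchTree-right st) p q

∈-below : {t l r : Tree (Fin n)} {u i : Fin n} → SearchTree t →
  node l u r ⊑ˡ t → i ∈ᵗ t → i Fin.< u → i ∈ᵗ l
∈-below st here i∈t i<u     = ∈-left st i∈t i<u
∈-below st (left q) i∈t i<u = ∈-below (SearchTree-left st) q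
  (∈-left st i∈t (Fin.<-trans i<u (left< st (_ , _ , ⊑ˡ⇒⊑ q)))) i<u

∈ˡ-below : {t l r : Tree (Fin n)} {u i : Fin n} → SearchTree t →
  node l u r ⊑ˡ t → i ∈ˡ t → i Fin.< u → i ∈ˡ l
∈ˡ-below st here i∈t i<u     = ∈ˡ-left st i∈t i<u
∈ˡ-below st (left q) i∈t i<u = ∈ˡ-below (SearchTree-left st) q
  (∈ˡ-left st i∈t (Fin.<-trans i<u (left< st (_ , _ , ⊑ˡ⇒⊑ q)))) i<u

-- Everything on the branch above s exceeds all of s.
∈ˡ-<⇒∈ˡ : {s t : Tree (Fin n)} {i j : Fin n} → SearchTree t →
  s ⊑ˡ t → j ∈ᵗ s → i ∈ˡ t → i Fin.< j → i ∈ˡ s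
∈ˡ-<⇒∈ˡ st here j∈s i∈t i<j     = i∈t
∈ˡ-<⇒∈ˡ st (left q) j∈s i∈t i<j = ∈ˡ-<⇒∈ˡ (SearchTree-left st) q j∈s
  (∈ˡ-left st i∈t (Fin.<-trans i<j (left< st (∈ᵗ-mono (⊑ˡ⇒⊑ q) j∈s)))) i<j

-- On the way down to `s`, both ends lie on the same side of each root passed, and this forces `j`
-- to that side. Both the noncrossing property of branches and the localisation of whole pattern
-- subtrees in `match-at` rest on this.
⊑-convex : {s t : Tree (Fin n)} {i j k : Fin n} → SearchTree t → s ⊑ t →
  i ∈ᵗ s → k ∈ᵗ s → j ∈ᵗ t → i Fin.≤ j → j Fin.≤ k → j ∈ᵗ s
⊑-convex st here      i∈s k∈s j∈t i≤j j≤k = j∈t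
⊑-convex st (left q)  i∈s k∈s j∈t i≤j j≤k = ⊑-convex (SearchTree-left st) q i∈s k∈s
  (∈-left st j∈t (ℕ.≤-<-trans j≤k (left< st (∈ᵗ-mono q k∈s)))) i≤j j≤k
⊑-convex st (right q) i∈s k∈s j∈t i≤j j≤k = ⊑-convex (SearchTree-right st) q i∈s k∈s
  (∈-right st j∈t (ℕ.<-≤-trans (right> st (∈ᵗ-mono q i∈s)) i≤j)) i≤j j≤k

bottom : {l r : Tree (Fin n)} {x : Fin n} → SearchTree (node l x r) →
  ∃[ b ] b ∈ˡ node l x r × (∀ {i} → i ∈ᵗ node l x r → b Fin.≤ i)
bottom {l = nil} {x = x} st = x , (_ , _ , here) , min
  where
  min : ∀ {i} → i ∈ᵗ node nil x _ → x Fin.≤ i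
  min i∈t with ∈ᵗ-split i∈t
  ... | inj₁ (_ , _ , ())
  ... | inj₂ (inj₁ refl) = ℕ.≤-refl
  ... | inj₂ (inj₂ i∈r)  = ℕ.<⇒≤ (right> st i∈r)
bottom {l = node l y r} {x = x} st with bottom (SearchTree-left st)
... | b , b∈l , b-min = b , ∈ˡ-mono (left here) b∈l , min
  where
  b<x : b Fin.< x
  b<x = left< st (∈ˡ⇒∈ᵗ b∈l)
  min : ∀ {i} → i ∈ᵗ node (node l y r) x _ → b Fin.≤ i
  min i∈t with ∈ᵗ-split i∈t
  ... | inj₁ i∈l         = b-min i∈l
  ... | inj₂ (inj₁ refl) = ℕ.<⇒≤ b<x
  ... | inj₂ (inj₂ i∈r)  = ℕ.<⇒≤ (Fin.<-trans b<x (right> st i∈r))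

min⇒∈ˡ : {t : Tree (Fin n)} {i : Fin n} → SearchTree t → i ∈ᵗ t →
  (∀ {j} → j ∈ᵗ t → i Fin.≤ j) → i ∈ˡ t
min⇒∈ˡ {t = nil}        st (_ , _ , ()) i-min
min⇒∈ˡ {t = node l x r} st i∈t i-min with bottom st
... | b , b∈t , b-min with Fin.≤-antisym (i-min (∈ˡ⇒∈ᵗ b∈t)) (b-min i∈t)
... | refl = b∈t

∈ˡ⇒∉right : {t l r : Tree (Fin n)} {u i : Fin n} → SearchTree t →
  node l u r ⊑ t → i ∈ᵗ r → ¬ i ∈ˡ t
∈ˡ⇒∉right st here i∈r i∈t      = ℕ.≤⇒≯ (∈ˡ⇒≤root st i∈t) (right> st i∈r)
∈ˡ⇒∉right st (left q) i∈r i∈t  = ∈ˡ⇒∉right (SearchTree-left st) q i∈r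
  (∈ˡ-left st i∈t (left< st (∈ᵗ-mono (⊑-trans (right here) q) i∈r)))
∈ˡ⇒∉right st (right q) i∈r i∈t =
  ℕ.≤⇒≯ (∈ˡ⇒≤root st i∈t) (right> st (∈ᵗ-mono (⊑-trans (right here) q) i∈r))

-- A right subtree is a union of whole maximal branches, so `i` alone carries `j` along. A left
-- subtree cuts the branch of its parent, which is why `SameBranch-left` assumes both memberships.
SameBranch-right : {t l r : Tree (Fin n)} {u i j : Fin n} → SearchTree t →
  node l u r ⊑ t → i ∈ᵗ r → SameBranch t i j → SameBranch r i j
SameBranch-right st q i∈r (s , here , i∈s , j∈s) = ⊥-elim (∈ˡ⇒∉right st q i∈r i∈s)
SameBranch-right st here i∈r (s , left p , i∈s , j∈s) =
  ⊥-elim (Fin.<-asym (left< st (∈ᵗ-mono p (∈ˡ⇒∈ᵗ i∈s))) (right> st i∈r))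
SameBranch-right st here i∈r (s , right p , i∈s , j∈s) = s , p , i∈s , j∈s
SameBranch-right st (left q) i∈r (s , left p , i∈s , j∈s) =
  SameBranch-right (SearchTree-left st) q i∈r (s , p , i∈s , j∈s)
SameBranch-right st (left q) i∈r (s , right p , i∈s , j∈s) =
  ⊥-elim (Fin.<-asym (left< st (∈ᵗ-mono (⊑-trans (right here) q) i∈r)) (right> st (∈ᵗ-mono p (∈ˡ⇒∈ᵗ i∈s))))
SameBranch-right st (right q) i∈r (s , left p , i∈s , j∈s) =
  ⊥-elim (Fin.<-asym (left< st (∈ᵗ-mono p (∈ˡ⇒∈ᵗ i∈s))) (right> st (∈ᵗ-mono (⊑-trans (right here) q) i∈r)))
SameBranch-right st (right q) i∈r (s , right p , i∈s , j∈s) =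
  SameBranch-right (SearchTree-right st) q i∈r (s , p , i∈s , j∈s)

SameBranch-left : {l r : Tree (Fin n)} {x i j : Fin n} → SearchTree (node l x r) →
  i ∈ᵗ l → j ∈ᵗ l → SameBranch (node l x r) i j → SameBranch l i j
SameBranch-left st i∈l j∈l (s , here , i∈s , j∈s) =
  _ , here , ∈ˡ-left st i∈s (left< st i∈l) , ∈ˡ-left st j∈s (left< st j∈l)
SameBranch-left st i∈l j∈l (s , left p , i∈s , j∈s)  = s , p , i∈s , j∈s
SameBranch-left st i∈l j∈l (s , right p , i∈s , j∈s) =
  ⊥-elim (Fin.<-asym (left< st i∈l) (right> st (∈ᵗ-mono p (∈ˡ⇒∈ᵗ i∈s))))

SameBranch⇒∈ˡ : {t l r : Tree (Fin n)} {i j : Fin n} → SearchTree t →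
  node l i r ⊑ t → SameBranch t i j → j Fin.≤ i → j ∈ˡ node l i r
SameBranch⇒∈ˡ {j = j} st q (s , p , (l′ , r′ , q′) , j∈s) j≤i
  with node-unique st q (⊑-trans (⊑ˡ⇒⊑ q′) p) | Fin.<-cmp j _
... | refl , refl | tri< j<i _ _    = ∈ˡ-mono (left here) (∈ˡ-below (SearchTree-⊑ p st) q′ j∈s j<i)
... | refl , refl | tri≈ _ refl _   = _ , _ , here
... | refl , refl | tri> _ _ j>i    = ⊥-elim (ℕ.≤⇒≯ j≤i j>i)

SameBranch-root : {t : Tree (Fin n)} {i j : Fin n} → SearchTree t →
  i ∈ˡ t → SameBranch t i j → j ∈ˡ t
SameBranch-root st i∈t K@(s , p , i∈s , j∈s) with ∈ᵗ-branch (∈ᵗ-mono p (∈ˡ⇒∈ᵗ j∈s))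
... | inj₁ j∈t                  = j∈t
... | inj₂ (l , u , r , q , j∈r) with SameBranch-right st (⊑ˡ⇒⊑ q) j∈r (SameBranch-sym K)
...   | s′ , p′ , _ , i∈s′ = ⊥-elim (∈ˡ⇒∉right st (⊑ˡ⇒⊑ q) (∈ᵗ-mono p′ (∈ˡ⇒∈ᵗ i∈s′)) i∈t)

-- If `j` were off the branch of `i` and `k`, it would lie in a right subtree `r` hanging from that
-- branch. Then `r` contains `m` as well, hence by convexity also `k`, which lies on the branch
-- itself.
SameBranch-noncrossing : {t : Tree (Fin n)} {i j k m : Fin n} → SearchTree t →
  i Fin.< j → j Fin.< k → k Fin.< m →
  SameBranch t i k → SameBranch t j m → SameBranch t i j
SameBranch-noncrossing {t = t} {i} {j} {k} {m} st i<j j<k k<m (s , p , i∈s , k∈s) K@(s′ , p′ , j∈s′ , _)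
  with ∈ᵗ-branch (⊑-convex st p (∈ˡ⇒∈ᵗ i∈s) (∈ˡ⇒∈ᵗ k∈s) (∈ᵗ-mono p′ (∈ˡ⇒∈ᵗ j∈s′)) (ℕ.<⇒≤ i<j) (ℕ.<⇒≤ j<k))
... | inj₁ j∈s = s , p , i∈s , j∈s
... | inj₂ (l , u , r , q , j∈r)
  with SameBranch-right st (⊑-trans (⊑ˡ⇒⊑ q) p) j∈r K
...   | s″ , p″ , _ , m∈s″ = ⊥-elim (∈ˡ⇒∉right sts (⊑ˡ⇒⊑ q) k∈r k∈s)
  where
  sts : SearchTree s
  sts = SearchTree-⊑ p st
  k∈r : k ∈ᵗ r
  k∈r = ⊑-convex sts (⊑-trans (right here) (⊑ˡ⇒⊑ q)) j∈r (∈ᵗ-mono p″ (∈ˡ⇒∈ᵗ m∈s″))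
    (∈ˡ⇒∈ᵗ k∈s) (ℕ.<⇒≤ j<k) (ℕ.<⇒≤ k<m)

-- Restricted growth strings and the blocks of a tree

infix 4 _∈ᵇ_
_∈ᵇ_ : Fin n → Block n → Set
i ∈ᵇ B = i ∈ List⁺.toList B

_∈ᵇ?_ : (i : Fin n) (B : Block n) → Dec (i ∈ᵇ B)
i ∈ᵇ? B = _∈?_ Fin._≟_ i (List⁺.toList B)

SameBlock : List (Block n) → Fin n → Fin n → Set
SameBlock Bs i j = Any (λ B → i ∈ᵇ B × j ∈ᵇ B) Bs

Disjoint : Block n → Block n → Set
Disjoint B C = ∀ i → ¬ (i ∈ᵇ B × i ∈ᵇ C)

-- Restricted growth is phrased by earlier occurrences instead of running maxima: each use starts
-- from a smaller letter and needs a position where it occurred before.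
IsRGS : Vec ℕ n → Set
IsRGS x = (∀ i → 1 ℕ.≤ lookup x i)
        × (∀ i v → 1 ℕ.≤ v → v ℕ.< lookup x i → ∃[ j ] j Fin.< i × lookup x j ≡ v)

smallest∈ : (B : Block n) → smallest B ∈ᵇ B
smallest∈ (x ∷ xs) with Extrema.argmin-sel (Fin.≤-totalOrder _) (λ y → y) x xs
... | inj₁ eq  = here eq
... | inj₂ m∈  = there m∈

smallest≤ : (B : Block n) {i : Fin n} → i ∈ᵇ B → smallest B Fin.≤ i
smallest≤ (x ∷ xs) (here refl) = Extrema.min≤⊤ (Fin.≤-totalOrder _) x xs
smallest≤ (x ∷ xs) (there i∈)  = All.lookup (Extrema.min≤xs (Fin.≤-totalOrder _) x xs) i∈

module _ (B : Block n) (Bs : List (Block n)) {i : Fin n} where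

  blockIndex-here : i ∈ᵇ B → blockIndex i (B ∷ Bs) ≡ 1
  blockIndex-here i∈B =
    cong (if_then 1 else ℕ.suc (blockIndex i Bs)) (dec-true (i ∈ᵇ? B) i∈B)

  blockIndex-there : ¬ i ∈ᵇ B → blockIndex i (B ∷ Bs) ≡ ℕ.suc (blockIndex i Bs)
  blockIndex-there i∉B =
    cong (if_then 1 else ℕ.suc (blockIndex i Bs)) (dec-false (i ∈ᵇ? B) i∉B)

blockIndex≥1 : {i : Fin n} {Bs : List (Block n)} → Any (i ∈ᵇ_) Bs → 1 ℕ.≤ blockIndex i Bs
blockIndex≥1 {i = i} {B ∷ Bs} _ with i ∈ᵇ? B
... | yes i∈B = ℕ.≤-reflexive (sym (blockIndex-here B Bs i∈B))
... | no i∉B  = subst (1 ℕ.≤_) (sym (blockIndex-there B Bs i∉B)) (s≤s z≤n)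

later∉ : {i : Fin n} {B : Block n} {Bs : List (Block n)} →
  All (Disjoint B) Bs → Any (i ∈ᵇ_) Bs → ¬ i ∈ᵇ B
later∉ (d ∷ ds) (here i∈C)   i∈B = d _ (i∈B , i∈C)
later∉ (d ∷ ds) (there i∈Bs) i∈B = later∉ ds i∈Bs i∈B

SameBlock⇒blockIndex : {i j : Fin n} {Bs : List (Block n)} → AllPairs Disjoint Bs →
  SameBlock Bs i j → blockIndex i Bs ≡ blockIndex j Bs
SameBlock⇒blockIndex {Bs = B ∷ Bs} (d ∷ ds) (here (i∈B , j∈B)) =
  trans (blockIndex-here B Bs i∈B) (sym (blockIndex-here B Bs j∈B))
SameBlock⇒blockIndex {Bs = B ∷ Bs} (d ∷ ds) (there s) =
  trans (blockIndex-there B Bs (later∉ d (Any.map proj₁ s)))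
    (trans (cong ℕ.suc (SameBlock⇒blockIndex ds s))
      (sym (blockIndex-there B Bs (later∉ d (Any.map proj₂ s)))))

blockIndex⇒SameBlock : {i j : Fin n} {Bs : List (Block n)} →
  Any (i ∈ᵇ_) Bs → Any (j ∈ᵇ_) Bs → blockIndex i Bs ≡ blockIndex j Bs → SameBlock Bs i j
blockIndex⇒SameBlock {i = i} {j} {B ∷ Bs} i∈ j∈ eq with i ∈ᵇ? B | j ∈ᵇ? B
... | yes i∈B | yes j∈B = here (i∈B , j∈B)
... | yes i∈B | no j∉B  = ⊥-elim (ℕ.<⇒≢ (blockIndex≥1 (Any.tail j∉B j∈)) (ℕ.suc-injective
        (trans (sym (blockIndex-here B Bs i∈B)) (trans eq (blockIndex-there B Bs j∉B)))))
... | no i∉B  | yes j∈B = ⊥-elim (ℕ.<⇒≢ (blockIndex≥1 (Any.tail i∉B i∈)) (ℕ.suc-injective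
        (trans (sym (blockIndex-here B Bs j∈B)) (trans (sym eq) (blockIndex-there B Bs i∉B)))))
... | no i∉B  | no j∉B  = there (blockIndex⇒SameBlock (Any.tail i∉B i∈) (Any.tail j∉B j∈) (ℕ.suc-injective
        (trans (sym (blockIndex-there B Bs i∉B)) (trans eq (blockIndex-there B Bs j∉B)))))

blockIndex-growth : {Bs : List (Block n)} → AllPairs Disjoint Bs →
  AllPairs (λ B C → smallest B Fin.≤ smallest C) Bs →
  ∀ {i} v → Any (i ∈ᵇ_) Bs → 1 ℕ.≤ v → v ℕ.< blockIndex i Bs →
  ∃[ j ] j Fin.< i × blockIndex j Bs ≡ v × Any (j ∈ᵇ_) Bs
blockIndex-growth {Bs = B ∷ Bs} (d ∷ ds) (o ∷ os) {i} v i∈ 1≤v v<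
  with i ∈ᵇ? B
... | yes i∈B = ⊥-elim (ℕ.<⇒≱ (subst (v ℕ.<_) (blockIndex-here B Bs i∈B) v<) 1≤v)
blockIndex-growth {Bs = B ∷ Bs} (d ∷ ds) (o ∷ os) {i} (ℕ.suc ℕ.zero) i∈ 1≤v v< | no i∉B =
  -- The blocks are sorted by smallest element, so that of `B` is at most the one of the block of
  -- `i`; it differs from `i` because `i` is not in `B`.
  smallest B , Fin.≤∧≢⇒< (below o (Any.tail i∉B i∈)) (λ eq → i∉B (subst (_∈ᵇ B) eq (smallest∈ B))) ,
  blockIndex-here B Bs (smallest∈ B) , here (smallest∈ B)
  where
  below : ∀ {Cs} → All (λ C → smallest B Fin.≤ smallest C) Cs → Any (i ∈ᵇ_) Cs → smallest B Fin.≤ i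
  below {C ∷ _} (p ∷ ps) (here i∈C) = ℕ.≤-trans p (smallest≤ C i∈C)
  below (p ∷ ps) (there i∈Cs)       = below ps i∈Cs
blockIndex-growth {Bs = B ∷ Bs} (d ∷ ds) (o ∷ os) {i} (ℕ.suc (ℕ.suc v)) i∈ 1≤v v< | no i∉B
  with blockIndex-growth ds os (ℕ.suc v) (Any.tail i∉B i∈) (s≤s z≤n) 
         (ℕ.s<s⁻¹ (subst (ℕ.suc (ℕ.suc v) ℕ.<_) (blockIndex-there B Bs i∉B) v<))
... | j , j<i , eq , j∈ =
  j , j<i , trans (blockIndex-there B Bs (later∉ d j∈)) (cong ℕ.suc eq) , there j∈

module _ {Bs : List (Block n)} (partition : IsSetPartition Bs) where

  private
    open DecTotalOrder (On.decTotalOrder (Fin.≤-decTotalOrder n) smallest) using (totalOrder)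
    open Sort (On.decTotalOrder (Fin.≤-decTotalOrder n) smallest) using (sort-↭; sort-↗)

    covers : ∀ i → Any (i ∈ᵇ_) (sortBlocks Bs)
    covers i = Any-resp-↭ (↭-sym (sort-↭ Bs)) (proj₁ partition i)

    disjoint : AllPairs Disjoint (sortBlocks Bs)
    disjoint = Permutation.AllPairs-resp-↭ (setoid (Block n))
      (λ d i (p , q) → d i (q , p)) (subst (Disjoint _) , subst (λ B → Disjoint B _))
      (↭⇒↭ₛ (↭-sym (sort-↭ Bs))) (proj₂ partition)

    lookup-rgs : ∀ i → lookup (rgs Bs) i ≡ blockIndex i (sortBlocks Bs)
    lookup-rgs = lookup∘tabulate _

  rgs-IsRGS : IsRGS (rgs Bs)
  rgs-IsRGS = (λ i → subst (1 ℕ.≤_) (sym (lookup-rgs i)) (blockIndex≥1 (covers i))) , growth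
    where
    growth : ∀ i v → 1 ℕ.≤ v → v ℕ.< lookup (rgs Bs) i → ∃[ j ] j Fin.< i × lookup (rgs Bs) j ≡ v
    growth i v 1≤v v<
      with blockIndex-growth disjoint (Sorted⇒AllPairs totalOrder (sort-↗ Bs)) v (covers i) 1≤v
             (subst (v ℕ.<_) (lookup-rgs i) v<)
    ... | j , j<i , eq , _ = j , j<i , trans (lookup-rgs j) eq

  rgs-kernel : ∀ i j → lookup (rgs Bs) i ≡ lookup (rgs Bs) j ⇔ SameBlock Bs i j
  rgs-kernel i j = mk⇔
    (λ eq → Any-resp-↭ (sort-↭ Bs) (blockIndex⇒SameBlock (covers i) (covers j)
       (trans (sym (lookup-rgs i)) (trans eq (lookup-rgs j)))))
    (λ s → trans (lookup-rgs i) (trans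
       (SameBlock⇒blockIndex disjoint (Any-resp-↭ (↭-sym (sort-↭ Bs)) s)) (sym (lookup-rgs j))))

module _ {x y : Vec ℕ n} (x-rgs : IsRGS x) (y-rgs : IsRGS y)
         (same : ∀ i j → lookup x i ≡ lookup x j ⇔ lookup y i ≡ lookup y j) where

  private
    open Equivalence
    -- A value of one string at i that is smaller than that of the other occurs earlier in
    -- the latter, hence by induction at the same earlier place in the former.
    agree : ∀ i → Acc Fin._<_ i → lookup x i ≡ lookup y i
    agree i (acc rec) with ℕ.<-cmp (lookup x i) (lookup y i)
    ... | tri≈ _ eq _ = eq
    ... | tri< x<y _ _ with proj₂ y-rgs i _ (proj₁ x-rgs i) x<y
    ...   | j , j<i , eq = ⊥-elim (ℕ.<⇒≢ x<y
              (trans (sym eq) (to (same j i) (trans (agree j (rec j<i)) eq))))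
    agree i (acc rec) | tri> _ _ y<x with proj₂ x-rgs i _ (proj₁ y-rgs i) y<x
    ...   | j , j<i , eq = ⊥-elim (ℕ.<⇒≢ y<x
              (trans (sym eq) (from (same j i) (trans (sym (agree j (rec j<i))) eq))))

  IsRGS-unique : x ≡ y
  IsRGS-unique = trans (sym (tabulate∘lookup x))
    (trans (tabulate-cong (λ i → agree i (<-wellFounded i))) (tabulate∘lookup y))

𝒫⇒IsRGS : {x : Vec ℕ n} → 𝒫 n x → IsRGS x
𝒫⇒IsRGS (Bs , partition , refl) = rgs-IsRGS partition

leftBranch⇒∈ˡ : {t : Tree (Fin n)} {i : Fin n} → i ∈ leftBranch t → i ∈ˡ t
leftBranch⇒∈ˡ {t = node l x r} (here refl) = _ , _ , here
leftBranch⇒∈ˡ {t = node l x r} (there i∈)  = ∈ˡ-mono (left here) (leftBranch⇒∈ˡ i∈)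

∈ˡ⇒leftBranch : {t : Tree (Fin n)} {i : Fin n} → i ∈ˡ t → i ∈ leftBranch t
∈ˡ⇒leftBranch (_ , _ , here)   = here refl
∈ˡ⇒leftBranch (_ , _ , left q) = there (∈ˡ⇒leftBranch (_ , _ , q))

-- One inclusion is enough for disjointness and for `SameBlock⇒SameBranch`; that blocks are not too
-- small is the content of `SameBranch⇒SameBlock`.
IsBranch : Tree (Fin n) → Block n → Set
IsBranch t B = ∃[ s ] s ⊑ t × (∀ {i} → i ∈ᵇ B → i ∈ˡ s)

IsBranch-mono : {s t : Tree (Fin n)} {B : Block n} → s ⊑ t → IsBranch s B → IsBranch t B
IsBranch-mono s⊑t (u , u⊑s , p) = u , ⊑-trans u⊑s s⊑t , p

mutual
  branches-IsBranch : (t : Tree (Fin n)) → All (IsBranch t) (maximalLeftBranches t)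
  branches-IsBranch nil            = []
  branches-IsBranch t@(node l x r) =
    (t , here , λ i∈ → leftBranch⇒∈ˡ i∈) ∷ lower-IsBranch t

  lower-IsBranch : (t : Tree (Fin n)) → All (IsBranch t) (lowerBranches t)
  lower-IsBranch nil          = []
  lower-IsBranch (node l x r) = All.++⁺
    (All.map (λ {B} → IsBranch-mono {B = B} (left here)) (lower-IsBranch l))
    (All.map (λ {B} → IsBranch-mono {B = B} (right here)) (branches-IsBranch r))

SameBlock⇒SameBranch : {t : Tree (Fin n)} {i j : Fin n} →
  SameBlock (maximalLeftBranches t) i j → SameBranch t i j
SameBlock⇒SameBranch {t = t} s with All.lookupAny (branches-IsBranch t) s
... | (u , u⊑t , p) , i∈ , j∈ = u , u⊑t , p i∈ , p j∈

SameBranch⇒SameBlock : {t : Tree (Fin n)} {i j : Fin n} →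
  SameBranch t i j → SameBlock (maximalLeftBranches t) i j
SameBranch⇒SameBlock {t = node l x r} (s , here , i∈ , j∈) = here (∈ˡ⇒leftBranch i∈ , ∈ˡ⇒leftBranch j∈)
SameBranch⇒SameBlock {t = node l@(node _ _ _) x r} (s , left p , i∈ , j∈)
  with SameBranch⇒SameBlock {t = l} (s , p , i∈ , j∈)
-- The first block of `l` is not a block of the whole tree: it is continued upwards by `x`. All
-- other blocks of `l` survive unchanged.
... | here (i∈′ , j∈′) = here (there i∈′ , there j∈′)
... | there q          = there (Any.++⁺ˡ q)
SameBranch⇒SameBlock {t = node nil x r} (s , left here , (_ , _ , ()) , j∈)
SameBranch⇒SameBlock {t = node l x r} (s , right p , i∈ , j∈) =
  there (Any.++⁺ʳ (lowerBranches l) (SameBranch⇒SameBlock {t = r} (s , p , i∈ , j∈)))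

mutual
  branches-disjoint : {t : Tree (Fin n)} → SearchTree t → AllPairs Disjoint (maximalLeftBranches t)
  branches-disjoint {t = nil} st          = []
  branches-disjoint {t = node l x r} st =
    All.++⁺ first
            (All.map (λ (s , p , f) i (i∈ , i∈C) → ℕ.≤⇒≯ (∈ˡ⇒≤root st (leftBranch⇒∈ˡ i∈))
               (right> st (∈ᵗ-mono p (∈ˡ⇒∈ᵗ (f i∈C))))) (branches-IsBranch r))
    ∷ lower-disjoint st
    where
    first : All (Disjoint (x ∷ leftBranch l)) (lowerBranches l)
    first = All.zipWith
      (λ { ((s , p , f) , d) i (here refl , i∈C) → Fin.<-irrefl refl (left< st (∈ᵗ-mono p (∈ˡ⇒∈ᵗ (f i∈C))))
         ; ((s , p , f) , d) i (there i∈ , i∈C)  → d i i∈ i∈C })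
      (lower-IsBranch l , apart (SearchTree-left st))

  -- The left branch is taken as a list so that the empty tree, which has no first block, is
  -- covered; this is the form needed when a root is put on top of `t`.
  apart : {t : Tree (Fin n)} → SearchTree t →
    All (λ C → ∀ i → i ∈ leftBranch t → ¬ i ∈ᵇ C) (lowerBranches t)
  apart {t = nil} st          = []
  apart {t = node l x r} st with branches-disjoint st
  ... | ds ∷ _ = All.map (λ d i i∈ i∈C → d i (i∈ , i∈C)) ds

  lower-disjoint : {t : Tree (Fin n)} → SearchTree t → AllPairs Disjoint (lowerBranches t)
  lower-disjoint {t = nil} st          = []
  lower-disjoint {t = node l x r} st = AllPairs.++⁺ (lower-disjoint (SearchTree-left st))
    (branches-disjoint (SearchTree-right st))
    (All.map (λ (s , p , f) → All.map (λ (s′ , p′ , f′) i (i∈B , i∈C) →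
       Fin.<-asym (left< st (∈ᵗ-mono p (∈ˡ⇒∈ᵗ (f i∈B)))) (right> st (∈ᵗ-mono p′ (∈ˡ⇒∈ᵗ (f′ i∈C)))))
       (branches-IsBranch r)) (lower-IsBranch l))

module _ {t : Tree (Fin n)} (t∈𝒯 : 𝒯 n t) where

  branches-IsSetPartition : IsSetPartition (maximalLeftBranches t)
  branches-IsSetPartition =
    (λ i → let _ , _ , q = proj₂ t∈𝒯 i in
       Any.map proj₁ (SameBranch⇒SameBlock {t = t} {i} {i} (_ , q , (_ , _ , here) , (_ , _ , here)))) ,
    branches-disjoint (proj₁ t∈𝒯)

  φL-IsRGS : IsRGS (φL t)
  φL-IsRGS = rgs-IsRGS branches-IsSetPartition

  -- Together with `φL-IsRGS` this is the interface to `φL`: sorting and block positions do not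
  -- appear beyond this point.
  φL-kernel : ∀ {i j} → lookup (φL t) i ≡ lookup (φL t) j ⇔ SameBranch t i j
  φL-kernel {i} {j} = mk⇔ (λ eq → SameBlock⇒SameBranch (to eq)) (λ s → from (SameBranch⇒SameBlock s))
    where open Equivalence (rgs-kernel branches-IsSetPartition i j)

-- Trees and noncrossing partitions

SameBranch-∈ : {t : Tree (Fin n)} {i j : Fin n} → SameBranch t i j → j ∈ᵗ t
SameBranch-∈ (s , p , _ , j∈s) = ∈ᵗ-mono p (∈ˡ⇒∈ᵗ j∈s)

branch⇒SameBranch : {t : Tree (Fin n)} {i j : Fin n} → i ∈ˡ t → j ∈ˡ t → SameBranch t i j
branch⇒SameBranch i∈t j∈t = _ , here , i∈t , j∈t

-- The root is the largest element on the branch of the minimum.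
root≤ : {l r l′ r′ : Tree (Fin n)} {x y : Fin n} →
  SearchTree (node l x r) → SearchTree (node l′ y r′) →
  (∀ i → i ∈ᵗ node l x r ⇔ i ∈ᵗ node l′ y r′) →
  (∀ i j → SameBranch (node l x r) i j → SameBranch (node l′ y r′) i j) → x Fin.≤ y
root≤ st st′ M K with bottom st
... | b , b∈t , b-min = ∈ˡ⇒≤root st′ (SameBranch-root st′
        (min⇒∈ˡ st′ (to (M b) (∈ˡ⇒∈ᵗ b∈t)) (λ j∈t′ → b-min (from (M _) j∈t′)))
        (K b _ (branch⇒SameBranch b∈t (_ , _ , here))))
  where open Equivalence

-- Label sets are compared along with branches because the induction passes to subtrees, which carry
-- only part of the labels.
SameBranch-unique : {t t′ : Tree (Fin n)} → SearchTree t → SearchTree t′ →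
  (∀ i → i ∈ᵗ t ⇔ i ∈ᵗ t′) → (∀ i j → SameBranch t i j ⇔ SameBranch t′ i j) → t ≡ t′
SameBranch-unique {t = nil}        {nil}           st st′ M K = refl
SameBranch-unique {t = nil}        {node l′ x′ r′} st st′ M K with Equivalence.from (M x′) root∈ᵗ
... | _ , _ , ()
SameBranch-unique {t = node l x r} {nil}           st st′ M K with Equivalence.to (M x) root∈ᵗ
... | _ , _ , ()
SameBranch-unique {t = node l x r} {node l′ x′ r′} st st′ M K
  with Fin.≤-antisym
         (root≤ st st′ M (λ i j → to (K i j)))
         (root≤ st′ st (λ i → mk⇔ (from (M i)) (to (M i))) (λ i j → from (K i j)))
  where open Equivalence
... | refl = cong₂ (λ u v → node u x v)
  (SameBranch-unique (SearchTree-left st) (SearchTree-left st′)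
    (λ i → mk⇔ (λ i∈ → ∈-left st′ (to (M i) (∈ᵗ-mono (left here) i∈)) (left< st i∈))
               (λ i∈ → ∈-left st (from (M i) (∈ᵗ-mono (left here) i∈)) (left< st′ i∈)))
    (λ i j → mk⇔ (left-half st st′ (λ i j → to (K i j))) (left-half st′ st (λ i j → from (K i j)))))
  (SameBranch-unique (SearchTree-right st) (SearchTree-right st′)
    (λ i → mk⇔ (λ i∈ → ∈-right st′ (to (M i) (∈ᵗ-mono (right here) i∈)) (right> st i∈))
               (λ i∈ → ∈-right st (from (M i) (∈ᵗ-mono (right here) i∈)) (right> st′ i∈)))
    (λ i j → mk⇔ (right-half st st′ (λ i j → to (K i j))) (right-half st′ st (λ i j → from (K i j)))))
  where
  open Equivalence
  module _ {l l′ r r′ : Tree (Fin n)} {x : Fin n} (st : SearchTree (node l x r)) (st′ : SearchTree (node l′ x r′))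
           (K : ∀ i j → SameBranch (node l x r) i j → SameBranch (node l′ x r′) i j) where
    left-half : ∀ {i j} → SameBranch l i j → SameBranch l′ i j
    left-half s = SameBranch-left st′
      (∈-left st′ (SameBranch-∈ (SameBranch-sym s′)) (left< st (SameBranch-∈ (SameBranch-sym s))))
      (∈-left st′ (SameBranch-∈ s′) (left< st (SameBranch-∈ s))) s′
      where s′ = K _ _ (SameBranch-mono (left here) s)
    right-half : ∀ {i j} → SameBranch r i j → SameBranch r′ i j
    right-half s = SameBranch-right st′ here
      (∈-right st′ (SameBranch-∈ (SameBranch-sym s′)) (right> st (SameBranch-∈ (SameBranch-sym s)))) s′
      where s′ = K _ _ (SameBranch-mono (right here) s)

φL-injective : {t t′ : Tree (Fin n)} → 𝒯 n t → 𝒯 n t′ → φL t ≡ φL t′ → t ≡ t′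
φL-injective t∈ t′∈ eq = SameBranch-unique (proj₁ t∈) (proj₁ t′∈)
  (λ i → mk⇔ (λ _ → proj₂ t′∈ i) (λ _ → proj₂ t∈ i))
  (λ i j → mk⇔
    (λ s → to (φL-kernel t′∈) (subst (λ v → lookup v i ≡ lookup v j) eq (from (φL-kernel t∈) s)))
    (λ s → to (φL-kernel t∈) (subst (λ v → lookup v i ≡ lookup v j) (sym eq) (from (φL-kernel t′∈) s))))
  where open Equivalence

-- The tree of a noncrossing partition

last : {P : Pred (Fin n) 0ℓ} → Decidable P → ∀ b → b ℕ.≤ n → ∀ {i} → P i → toℕ i ℕ.< b →
  ∃[ m ] P m × toℕ m ℕ.< b × (∀ {j} → P j → toℕ j ℕ.< b → j Fin.≤ m)
last {P = P} P? (ℕ.suc b) b<n Pi i<b with P? (Fin.fromℕ< b<n)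
... | yes Pb = _ , Pb , s≤s (ℕ.≤-reflexive (Fin.toℕ-fromℕ< b<n)) ,
               λ _ j<b → subst (_ ℕ.≤_) (sym (Fin.toℕ-fromℕ< b<n)) (ℕ.s≤s⁻¹ j<b)
... | no ¬Pb = extend (last P? b (ℕ.<⇒≤ b<n) Pi (shrink Pi i<b))
  where
  shrink : ∀ {j} → P j → toℕ j ℕ.< ℕ.suc b → toℕ j ℕ.< b
  shrink Pj j<b = ℕ.≤∧≢⇒< (ℕ.s≤s⁻¹ j<b) λ eq →
    ¬Pb (subst P (Fin.toℕ-injective (trans eq (sym (Fin.toℕ-fromℕ< b<n)))) Pj)
  extend : ∃[ m ] P m × toℕ m ℕ.< b × (∀ {j} → P j → toℕ j ℕ.< b → j Fin.≤ m) →
    ∃[ m ] P m × toℕ m ℕ.< ℕ.suc b × (∀ {j} → P j → toℕ j ℕ.< ℕ.suc b → j Fin.≤ m)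
  extend (m , Pm , m<b , m-max) =
    m , Pm , ℕ.m<n⇒m<1+n m<b , λ Pj j<b → m-max Pj (shrink Pj j<b)

SearchTree-node : {l r : Tree (Fin n)} {x : Fin n} → SearchTree l → SearchTree r →
  (∀ {i} → i ∈ᵗ l → i Fin.< x) → (∀ {i} → i ∈ᵗ r → x Fin.< i) → SearchTree (node l x r)
SearchTree-node (L , R) (L′ , R′) l<x x<r =
  (λ { i j (_ , _ , here , j∈)    → l<x j∈
     ; i j (_ , _ , left q , j∈)  → L i j (_ , _ , q , j∈)
     ; i j (_ , _ , right q , j∈) → L′ i j (_ , _ , q , j∈) }) ,
  (λ { i j (_ , _ , here , j∈)    → x<r j∈
     ; i j (_ , _ , left q , j∈)  → R i j (_ , _ , q , j∈)
     ; i j (_ , _ , right q , j∈) → R′ i j (_ , _ , q , j∈) })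

Noncrossing : (Fin n → ℕ) → Set
Noncrossing c = ∀ {i j k m} → i Fin.< j → j Fin.< k → k Fin.< m → c i ≡ c k → c j ≡ c m → c i ≡ c j

module _ (c : Fin n → ℕ) (nc : Noncrossing c) where

  -- Intervals are half-open so that a root `m` splits `a`, `b` into `a`, `m` and `suc m`, `b`.
  -- `complete` speaks of ordered pairs, which halves the case analysis; `φL-surjective` restores
  -- the other order by symmetry.
  record Realises (a b : ℕ) (t : Tree (Fin n)) : Set where
    field
      search   : SearchTree t
      ∈⇒≥      : ∀ {i} → i ∈ᵗ t → a ℕ.≤ toℕ i
      ∈⇒<      : ∀ {i} → i ∈ᵗ t → toℕ i ℕ.< b
      ⇒∈       : ∀ {i} → a ℕ.≤ toℕ i → toℕ i ℕ.< b → i ∈ᵗ t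
      sound    : ∀ {i j} → SameBranch t i j → c i ≡ c j
      complete : ∀ {i j} → i ∈ᵗ t → j ∈ᵗ t → i Fin.≤ j → c i ≡ c j → SameBranch t i j

  open Realises

  realise-node : ∀ {a b l r} {s m : Fin n} → toℕ s ≡ a → a ℕ.≤ toℕ m → toℕ m ℕ.< b →
    c m ≡ c s → (∀ {j} → c j ≡ c s → toℕ j ℕ.< b → j Fin.≤ m) →
    Realises a (toℕ m) l → Realises (ℕ.suc (toℕ m)) b r → Realises a b (node l m r)
  realise-node {a} {b} {l} {r} {s} {m} refl a≤m m<b cm≡cs m-max L R = record
    { search = st
    ; ∈⇒≥ = λ i∈ → lower (∈ᵗ-split i∈)
    ; ∈⇒< = λ i∈ → upper (∈ᵗ-split i∈)
    ; ⇒∈ = member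
    ; sound = snd
    ; complete = cmp
    }
    where
    st : SearchTree (node l m r)
    st = SearchTree-node (search L) (search R) (∈⇒< L) (∈⇒≥ R)

    lower : ∀ {i} → i ∈ᵗ l ⊎ i ≡ m ⊎ i ∈ᵗ r → a ℕ.≤ toℕ i
    lower (inj₁ i∈l)         = ∈⇒≥ L i∈l
    lower (inj₂ (inj₁ refl)) = a≤m
    lower (inj₂ (inj₂ i∈r))  = ℕ.≤-trans a≤m (ℕ.<⇒≤ (∈⇒≥ R i∈r))

    upper : ∀ {i} → i ∈ᵗ l ⊎ i ≡ m ⊎ i ∈ᵗ r → toℕ i ℕ.< b
    upper (inj₁ i∈l)         = ℕ.<-trans (∈⇒< L i∈l) m<b
    upper (inj₂ (inj₁ refl)) = m<b
    upper (inj₂ (inj₂ i∈r))  = ∈⇒< R i∈r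

    member : ∀ {i} → a ℕ.≤ toℕ i → toℕ i ℕ.< b → i ∈ᵗ node l m r
    member {i} a≤i i<b with Fin.<-cmp i m
    ... | tri< i<m _ _  = ∈ᵗ-mono (left here) (⇒∈ L a≤i i<m)
    ... | tri≈ _ refl _ = root∈ᵗ
    ... | tri> _ _ m<i  = ∈ᵗ-mono (right here) (⇒∈ R m<i i<b)

    s∈ˡl : ∀ {i} → i ∈ᵗ l → s ∈ˡ l
    s∈ˡl i∈l = min⇒∈ˡ (search L) (⇒∈ L ℕ.≤-refl (ℕ.≤-<-trans (∈⇒≥ L i∈l) (∈⇒< L i∈l))) (∈⇒≥ L)

    ∈ˡ⇒≡ : ∀ {i} → i ∈ˡ node l m r → c i ≡ c s
    ∈ˡ⇒≡ i∈t with ∈ˡ-split i∈t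
    ... | inj₁ refl = cm≡cs
    ... | inj₂ i∈l  = sound L (branch⇒SameBranch i∈l (s∈ˡl (∈ˡ⇒∈ᵗ i∈l)))

    ≡⇒∈ˡ : ∀ {i} → i ∈ᵗ l → c i ≡ c s → i ∈ˡ l
    ≡⇒∈ˡ i∈l ci≡cs = SameBranch-root (search L) (s∈ˡl i∈l)
      (complete L (∈ˡ⇒∈ᵗ (s∈ˡl i∈l)) i∈l (∈⇒≥ L i∈l) (sym ci≡cs))

    snd : ∀ {i j} → SameBranch (node l m r) i j → c i ≡ c j
    snd (u , here , i∈ , j∈)    = trans (∈ˡ⇒≡ i∈) (sym (∈ˡ⇒≡ j∈))
    snd (u , left p , i∈ , j∈)  = sound L (u , p , i∈ , j∈)
    snd (u , right p , i∈ , j∈) = sound R (u , p , i∈ , j∈)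

    cross : ∀ {i j} → i ∈ᵗ l → j ∈ᵗ r → ¬ c i ≡ c j
    cross {i} {j} i∈l j∈r ci≡cj with Fin.<-cmp s i
    ... | tri> _ _ i<s  = ℕ.<⇒≱ i<s (∈⇒≥ L i∈l)
    ... | tri≈ _ refl _ = ℕ.<⇒≱ (∈⇒≥ R j∈r) (m-max (sym ci≡cj) (∈⇒< R j∈r))
    -- Noncrossing for `s` < `i` < `m` < `j` would put `j` into the block of `s`, beyond its last
    -- label `m`.
    ... | tri< s<i _ _  = ℕ.<⇒≱ (∈⇒≥ R j∈r) (m-max
            (trans (sym ci≡cj) (sym (nc s<i (∈⇒< L i∈l) (∈⇒≥ R j∈r) (sym cm≡cs) ci≡cj))) (∈⇒< R j∈r))

    cmp : ∀ {i j} → i ∈ᵗ node l m r → j ∈ᵗ node l m r → i Fin.≤ j → c i ≡ c j →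
      SameBranch (node l m r) i j
    cmp {i} {j} i∈ j∈ i≤j eq with ∈ᵗ-split i∈ | ∈ᵗ-split j∈
    ... | inj₁ i∈l         | inj₁ j∈l         = SameBranch-mono (left here) (complete L i∈l j∈l i≤j eq)
    ... | inj₁ i∈l         | inj₂ (inj₁ refl) =
            branch⇒SameBranch (∈ˡ-mono (left here) (≡⇒∈ˡ i∈l (trans eq cm≡cs))) (_ , _ , here)
    ... | inj₁ i∈l         | inj₂ (inj₂ j∈r)  = ⊥-elim (cross i∈l j∈r eq)
    ... | inj₂ (inj₁ refl) | inj₁ j∈l         = ⊥-elim (ℕ.<⇒≱ (∈⇒< L j∈l) i≤j)
    ... | inj₂ (inj₁ refl) | inj₂ (inj₁ refl) = branch⇒SameBranch (_ , _ , here) (_ , _ , here)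
    ... | inj₂ (inj₁ refl) | inj₂ (inj₂ j∈r)  =
            ⊥-elim (ℕ.<⇒≱ (∈⇒≥ R j∈r) (m-max (trans (sym eq) cm≡cs) (∈⇒< R j∈r)))
    ... | inj₂ (inj₂ i∈r)  | inj₁ j∈l         =
            ⊥-elim (ℕ.<⇒≱ (ℕ.<-trans (∈⇒< L j∈l) (∈⇒≥ R i∈r)) i≤j)
    ... | inj₂ (inj₂ i∈r)  | inj₂ (inj₁ refl) = ⊥-elim (ℕ.<⇒≱ (∈⇒≥ R i∈r) i≤j)
    ... | inj₂ (inj₂ i∈r)  | inj₂ (inj₂ j∈r)  = SameBranch-mono (right here) (complete R i∈r j∈r i≤j eq)

  realise-nil : ∀ {a b} → b ℕ.≤ a → Realises a b nil
  realise-nil b≤a = record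
    { search   = (λ { _ _ (_ , _ , () , _) }) , (λ { _ _ (_ , _ , () , _) })
    ; ∈⇒≥      = λ { (_ , _ , ()) }
    ; ∈⇒<      = λ { (_ , _ , ()) }
    ; ⇒∈       = λ a≤i i<b → ⊥-elim (ℕ.<⇒≱ i<b (ℕ.≤-trans b≤a a≤i))
    ; sound    = λ { (_ , here , (_ , _ , ()) , _) }
    ; complete = λ { (_ , _ , ()) }
    }

  -- `d` bounds the length of the interval and drops because neither of the two smaller intervals
  -- contains the root `m`.
  realise : ∀ d a b → b ℕ.≤ a ℕ.+ d → b ℕ.≤ n → ∃ (Realises a b)
  realise ℕ.zero a b b≤a b≤n = nil , realise-nil (subst (b ℕ.≤_) (ℕ.+-identityʳ a) b≤a)
  realise (ℕ.suc d) a b b≤a+d b≤n with a ℕ.<? b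
  ... | no a≮b = nil , realise-nil (ℕ.≮⇒≥ a≮b)
  ... | yes a<b
    with last (λ j → c j ℕ.≟ c s) b b≤n {s} refl (subst (ℕ._< b) (sym s≡a) a<b)
    where
    s = Fin.fromℕ< (ℕ.<-≤-trans a<b b≤n)
    s≡a = Fin.toℕ-fromℕ< (ℕ.<-≤-trans a<b b≤n)
  ... | m , cm≡cs , m<b , m-max =
    _ , realise-node s≡a a≤m m<b cm≡cs m-max
      (proj₂ (realise d a (toℕ m)
        (ℕ.s≤s⁻¹ (ℕ.≤-trans m<b (subst (b ℕ.≤_) (ℕ.+-suc a d) b≤a+d))) (ℕ.<⇒≤ (Fin.toℕ<n m))))
      (proj₂ (realise d (ℕ.suc (toℕ m)) b
        (ℕ.≤-trans b≤a+d (ℕ.≤-trans (ℕ.≤-reflexive (ℕ.+-suc a d)) (s≤s (ℕ.+-monoˡ-≤ d a≤m)))) b≤n))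
    where
    s = Fin.fromℕ< (ℕ.<-≤-trans a<b b≤n)
    s≡a = Fin.toℕ-fromℕ< (ℕ.<-≤-trans a<b b≤n)
    a≤m : a ℕ.≤ toℕ m
    a≤m = subst (ℕ._≤ toℕ m) s≡a (m-max refl (subst (ℕ._< b) (sym s≡a) a<b))

φL-surjective : {x : Vec ℕ n} → IsRGS x → Noncrossing (lookup x) → ∃[ t ] 𝒯 n t × φL t ≡ x
φL-surjective {n = n} {x} x-rgs nc with realise (lookup x) nc n 0 n ℕ.≤-refl ℕ.≤-refl
... | t , R = t , t∈𝒯 , IsRGS-unique (φL-IsRGS t∈𝒯) x-rgs
    (λ i j → mk⇔ (λ eq → sound (to (φL-kernel t∈𝒯) eq))
                 (λ eq → from (φL-kernel t∈𝒯) (same eq)))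
  where
  open Equivalence
  open Realises R
  t∈𝒯 : 𝒯 n t
  t∈𝒯 = search , λ i → ⇒∈ z≤n (Fin.toℕ<n i)
  same : ∀ {i j} → lookup x i ≡ lookup x j → SameBranch t i j
  same {i} {j} eq with Fin.≤-total i j
  ... | inj₁ i≤j = complete (proj₂ t∈𝒯 i) (proj₂ t∈𝒯 j) i≤j eq
  ... | inj₂ j≤i = SameBranch-sym (complete (proj₂ t∈𝒯 j) (proj₂ t∈𝒯 i) j≤i (sym eq))

-- Occurrences of string patterns and the pattern 1212

StringContains-mono : (x : Vec ℕ n) (τ : Vec ℕ k) (ι : Fin k → Fin n) →
  (∀ a b → a Fin.< b → ι a Fin.< ι b) →
  (∀ a b → lookup τ a ℕ.< lookup τ b → lookup x (ι a) ℕ.< lookup x (ι b)) →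
  (∀ a b → lookup τ a ≡ lookup τ b → lookup x (ι a) ≡ lookup x (ι b)) →
  StringContains x τ
-- The letters of `τ` are linearly ordered, so a map that preserves both `<` and equality also
-- reflects them.
StringContains-mono x τ ι mono lt eq =
  ι , mono , (λ a b → mk⇔ (lt⁻ a b) (lt a b)) , (λ a b → mk⇔ (eq⁻ a b) (eq a b))
  where
  lt⁻ : ∀ a b → lookup x (ι a) ℕ.< lookup x (ι b) → lookup τ a ℕ.< lookup τ b
  lt⁻ a b p with ℕ.<-cmp (lookup τ a) (lookup τ b)
  ... | tri< q _ _ = q
  ... | tri≈ _ q _ = ⊥-elim (ℕ.<⇒≢ p (eq a b q))
  ... | tri> _ _ q = ⊥-elim (ℕ.<-asym p (lt b a q))
  eq⁻ : ∀ a b → lookup x (ι a) ≡ lookup x (ι b) → lookup τ a ≡ lookup τ b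
  eq⁻ a b p with ℕ.<-cmp (lookup τ a) (lookup τ b)
  ... | tri< q _ _ = ⊥-elim (ℕ.<⇒≢ (lt a b q) p)
  ... | tri≈ _ q _ = q
  ... | tri> _ _ q = ⊥-elim (ℕ.<⇒≢ (lt b a q) (sym p))

1212-pattern : Vec ℕ 4
1212-pattern = 1 ∷ 2 ∷ 1 ∷ 2 ∷ []

contains-1212 : (x : Vec ℕ n) {i j k m : Fin n} → i Fin.< j → j Fin.< k → k Fin.< m →
  lookup x i ≡ lookup x k → lookup x j ≡ lookup x m → lookup x i ℕ.< lookup x j →
  StringContains x 1212-pattern
contains-1212 {n = n} x {i} {j} {k} {m} i<j j<k k<m i~k j~m xi<xj = StringContains-mono x 1212-pattern ι
  (λ { zero (suc zero) _ → i<j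
     ; zero (suc (suc zero)) _ → ℕ.<-trans i<j j<k
     ; zero (suc (suc (suc zero))) _ → ℕ.<-trans i<j (ℕ.<-trans j<k k<m)
     ; (suc zero) (suc (suc zero)) _ → j<k
     ; (suc zero) (suc (suc (suc zero))) _ → ℕ.<-trans j<k k<m
     ; (suc (suc zero)) (suc (suc (suc zero))) _ → k<m
     ; (suc zero) (suc zero) (s≤s ())
     ; (suc (suc zero)) (suc zero) (s≤s ())
     ; (suc (suc (suc zero))) (suc zero) (s≤s ())
     ; (suc (suc zero)) (suc (suc zero)) (s≤s (s≤s ()))
     ; (suc (suc (suc zero))) (suc (suc zero)) (s≤s (s≤s ()))
     ; (suc (suc (suc zero))) (suc (suc (suc zero))) (s≤s (s≤s (s≤s ()))) })
  lt eq
  where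
  ι : Fin 4 → Fin n
  ι = lookup (i ∷ j ∷ k ∷ m ∷ [])

  letter : ∀ a → lookup 1212-pattern a ≡ 1 × lookup x (ι a) ≡ lookup x i
               ⊎ lookup 1212-pattern a ≡ 2 × lookup x (ι a) ≡ lookup x j
  letter zero                   = inj₁ (refl , refl)
  letter (suc zero)             = inj₂ (refl , refl)
  letter (suc (suc zero))       = inj₁ (refl , sym i~k)
  letter (suc (suc (suc zero))) = inj₂ (refl , sym j~m)

  lt : ∀ a b → lookup 1212-pattern a ℕ.< lookup 1212-pattern b → lookup x (ι a) ℕ.< lookup x (ι b)
  lt a b p with letter a | letter b
  ... | inj₁ (τa , xa) | inj₂ (τb , xb) = subst₂ ℕ._<_ (sym xa) (sym xb) xi<xj
  ... | inj₁ (τa , xa) | inj₁ (τb , xb) = ⊥-elim (ℕ.<⇒≢ p (trans τa (sym τb)))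
  ... | inj₂ (τa , xa) | inj₂ (τb , xb) = ⊥-elim (ℕ.<⇒≢ p (trans τa (sym τb)))
  ... | inj₂ (τa , xa) | inj₁ (τb , xb) = ⊥-elim (ℕ.<-asym (subst₂ ℕ._<_ τa τb p) (s≤s (s≤s z≤n)))

  eq : ∀ a b → lookup 1212-pattern a ≡ lookup 1212-pattern b → lookup x (ι a) ≡ lookup x (ι b)
  eq a b p with letter a | letter b
  ... | inj₁ (τa , xa) | inj₁ (τb , xb) = trans xa (sym xb)
  ... | inj₂ (τa , xa) | inj₂ (τb , xb) = trans xa (sym xb)
  ... | inj₁ (τa , xa) | inj₂ (τb , xb) with trans (sym τa) (trans p τb)
  ...   | ()
  eq a b p | inj₂ (τa , xa) | inj₁ (τb , xb) with trans (sym τa) (trans p τb)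
  ...   | ()

avoids-1212⇒Noncrossing : {x : Vec ℕ n} → IsRGS x → ¬ StringContains x 1212-pattern →
  Noncrossing (lookup x)
avoids-1212⇒Noncrossing {x = x} x-rgs avoids {i} {j} i<j j<k k<m i~k j~m
  with ℕ.<-cmp (lookup x i) (lookup x j)
... | tri≈ _ eq _ = eq
... | tri< xi<xj _ _ = ⊥-elim (avoids (contains-1212 x i<j j<k k<m i~k j~m xi<xj))
-- The crossing reads 2121 here. The smaller letter has occurred at some `h` before `i`, and `h`,
-- `i`, `j`, `k` form 1212.
... | tri> _ _ xj<xi with proj₂ x-rgs i _ (proj₁ x-rgs j) xj<xi
...   | h , h<i , h~j = ⊥-elim (avoids
          (contains-1212 x h<i i<j j<k h~j i~k (subst (ℕ._< lookup x i) (sym h~j) xj<xi)))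

φL-avoids-1212 : {t : Tree (Fin n)} → 𝒯 n t → ¬ StringContains (φL t) 1212-pattern
φL-avoids-1212 t∈𝒯 (ι , mono , lt , eq) =
  1≢2 (to (eq zero (suc zero)) (from (φL-kernel t∈𝒯) (SameBranch-noncrossing (proj₁ t∈𝒯)
    (mono zero (suc zero) (s≤s z≤n))
    (mono (suc zero) (suc (suc zero)) (s≤s (s≤s z≤n)))
    (mono (suc (suc zero)) (suc (suc (suc zero))) (s≤s (s≤s (s≤s z≤n))))
    (to (φL-kernel t∈𝒯) (from (eq zero (suc (suc zero))) refl))
    (to (φL-kernel t∈𝒯) (from (eq (suc zero) (suc (suc (suc zero)))) refl)))))
  where
  open Equivalence
  1≢2 : 1 ≢ 2
  1≢2 ()

-- Staggered patterns

-- An edge off the root branch lies in the right subtree of some branch vertex. Uniqueness of the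
-- branching vertex and distinctness of labels identify that subtree with the one on which the
-- staggered structure continues.
staggered-left : {t : Tree (Fin k)} {e : EdgeLabelling t} → SearchTree t → Staggered t e →
  ∀ p i (c : LeftChild t p i) → e i (p , inj₁ c) ≡ contiguous
staggered-left st (leftPath _ cont) p i c = cont i (p , inj₁ c)
staggered-left st (branching cont q uniq _ s) p i (a , b , r , p⊑t) with ⊑-split p⊑t
... | inj₁ p⊑ˡt = cont p⊑ˡt
... | inj₂ (l′ , u , node _ _ _ , u⊑t , p⊑r) with uniq u⊑t
...   | refl with node-unique st (⊑ˡ⇒⊑ u⊑t) (⊑ˡ⇒⊑ q)
...     | refl , refl = staggered-left (SearchTree-⊑ (⊑-trans (right here) (⊑ˡ⇒⊑ q)) st) s p i (a , b , r , p⊑r)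
staggered-left st (branching cont q uniq _ s) p i (a , b , r , p⊑t) | inj₂ (l′ , u , nil , u⊑t , ())

staggered-right : {t : Tree (Fin k)} {e : EdgeLabelling t} → SearchTree t → Staggered t e →
  ∀ p i (c : RightChild t p i) → e i (p , inj₂ c) ≡ noncontiguous
staggered-right st (leftPath noRight _) p i c = ⊥-elim (noRight p i c)
staggered-right st (branching cont q uniq nc s) p i (l , a , b , p⊑t) with ⊑-split p⊑t
... | inj₁ p⊑ˡt with uniq p⊑ˡt
...   | refl with node-unique st p⊑t (⊑ˡ⇒⊑ q)
...     | refl , refl = nc
staggered-right st (branching cont q uniq nc s) p i (l , a , b , p⊑t)
    | inj₂ (l′ , u , node _ _ _ , u⊑t , p⊑r) with uniq u⊑t
...   | refl with node-unique st (⊑ˡ⇒⊑ u⊑t) (⊑ˡ⇒⊑ q)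
...     | refl , refl = staggered-right (SearchTree-⊑ (⊑-trans (right here) (⊑ˡ⇒⊑ q)) st) s p i (l , a , b , p⊑r)
staggered-right st (branching cont q uniq nc s) p i (l , a , b , p⊑t) | inj₂ (l′ , u , nil , u⊑t , ())

data LeftPath {A : Set} : Tree A → Set where
  nil  : LeftPath nil
  node : ∀ {l x} → LeftPath l → LeftPath (node l x nil)

-- By condition (ii) a right child starting a further branch has no right child itself.
data Spine {A : Set} : Tree A → Set where
  nil    : Spine nil
  up     : ∀ {l x} → Spine l → Spine (node l x nil)
  branch : ∀ {l x a j} → LeftPath l → Spine (node a j nil) → Spine (node l x (node a j nil))

LeftPath⇒Spine : {t : Tree A} → LeftPath t → Spine t
LeftPath⇒Spine nil      = nil
LeftPath⇒Spine (node p) = up (LeftPath⇒Spine p)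

-- The shapes left by condition (i): the root has a right child only if α₁ ≤ 2.
data Pattern {A : Set} : Tree A → Set where
  up     : ∀ {l x} → Spine l → Pattern (node l x nil)
  single : ∀ {x a j} → Spine (node a j nil) → Pattern (node nil x (node a j nil))
  double : ∀ {x y a j} → Spine (node a j nil) → Pattern (node (node nil y nil) x (node a j nil))

Pattern⇒Spine : {t : Tree A} → Pattern t → Spine t
Pattern⇒Spine (up s)     = up s
Pattern⇒Spine (single s) = branch nil s
Pattern⇒Spine (double s) = branch (node nil) s

LeftPath-intro : (t : Tree A) → (∀ {l i a j b} → ¬ node l i (node a j b) ⊑ˡ t) → LeftPath t
LeftPath-intro nil noRight                       = nil
LeftPath-intro (node l x nil) noRight            = node (LeftPath-intro l λ q → noRight (left q))
LeftPath-intro (node l x (node a j b)) noRight   = ⊥-elim (noRight here)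

UniqueRight : Tree A → A → Set
UniqueRight t i = ∀ {l′ i′ a′ j′ b′} → node l′ i′ (node a′ j′ b′) ⊑ˡ t → i′ ≡ i

above-nil : {t l r u : Tree (Fin k)} {x i : Fin k} → SearchTree (node t x r) → node l i u ⊑ˡ t →
  UniqueRight (node t x r) i → r ≡ nil
above-nil {r = nil}        st q uniq = refl
above-nil {r = node a j b} st q uniq =
  ⊥-elim (Fin.<⇒≢ (left< st (_ , _ , ⊑ˡ⇒⊑ q)) (sym (uniq here)))

below-LeftPath : {l r : Tree (Fin k)} {i : Fin k} → SearchTree (node l i r) →
  UniqueRight (node l i r) i → LeftPath l
below-LeftPath {l = l} st uniq = LeftPath-intro l λ q →
  Fin.<⇒≢ (left< st (_ , _ , ⊑ˡ⇒⊑ q)) (uniq (left q))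

branching-Spine : {t l a : Tree (Fin k)} {i j : Fin k} → SearchTree t → node l i (node a j nil) ⊑ˡ t →
  UniqueRight t i → Spine (node a j nil) → Spine t
branching-Spine st here uniq s = branch (below-LeftPath st uniq) s
branching-Spine st (left q) uniq s with above-nil st q uniq
... | refl = up (branching-Spine (SearchTree-left st) q (λ p → uniq (left p)) s)

leftPath-Spine : {l r : Tree A} {x : A} → (∀ i j → ¬ RightChild (node l x r) i j) →
  Spine l × r ≡ nil
leftPath-Spine {l = l} {nil} noRight =
  LeftPath⇒Spine (LeftPath-intro l (λ q → noRight _ _ (_ , _ , _ , left (⊑ˡ⇒⊑ q)))) , refl
leftPath-Spine {r = node a j b} noRight = ⊥-elim (noRight _ _ (_ , _ , _ , here))

staggered-Spine : {t : Tree (Fin k)} {e : EdgeLabelling t} → SearchTree t → (s : Staggered t e) →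
  let open Signature (signature s) in
  ((i : Fin ℓ∸1) → lookup β i ℕ.< lookup α (inject₁ i)) →
  ∃₂ λ a j → t ≡ node a j nil × Spine a
staggered-Spine st (leftPath noRight _) β<α with leftPath-Spine noRight
... | s , refl = _ , _ , refl , s
-- Branching at the root makes the first entries of `β` and `α` the length of the same left branch,
-- against strictness.
staggered-Spine st (branching _ here _ _ _) β<α = ⊥-elim (ℕ.<-irrefl refl (β<α zero))
staggered-Spine st (branching _ (left q) uniq _ s) β<α
  with staggered-Spine (SearchTree-⊑ (⊑-trans (right here) (left (⊑ˡ⇒⊑ q))) st) s (λ i → β<α (suc i))
     | above-nil st q uniq
... | _ , _ , refl , sp | refl =
  _ , _ , refl , branching-Spine (SearchTree-left st) q (λ p → uniq (left p)) (up sp)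

short-Pattern : {l a : Tree A} {x j : A} → LeftPath l → Spine (node a j nil) →
  ℕ.suc (length (leftBranch l)) ≡ 1 ⊎ ℕ.suc (length (leftBranch l)) ≡ 2 →
  Pattern (node l x (node a j nil))
short-Pattern nil             s _         = single s
short-Pattern (node nil)      s _         = double s
short-Pattern (node (node _)) s (inj₁ ())
short-Pattern (node (node _)) s (inj₂ ())

staggered-Pattern : {t : Tree (Fin k)} {e : EdgeLabelling t} → SearchTree t → (s : Staggered t e) →
  let open Signature (signature s) in
  ((i : Fin ℓ∸1) → toℕ i ≡ 0 → lookup β i ≡ lookup α (inject₁ i) →
     lookup α (inject₁ i) ≡ 1 ⊎ lookup α (inject₁ i) ≡ 2) →
  ((i : Fin ℓ∸1) → 1 ℕ.≤ toℕ i → lookup β i ℕ.< lookup α (inject₁ i)) →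
  Pattern t
staggered-Pattern st (leftPath noRight _) h₁ h₂ with leftPath-Spine noRight
... | s , refl = up s
staggered-Pattern st (branching _ q uniq _ s) h₁ h₂
  -- Dropping the first branch shifts indices by one, so condition (ii) becomes strictness at every
  -- branching of the remaining pattern.
  with staggered-Spine (SearchTree-⊑ (⊑-trans (right here) (⊑ˡ⇒⊑ q)) st) s (λ i → h₂ (suc i) (s≤s z≤n))
staggered-Pattern st (branching _ (left q) uniq _ s) h₁ h₂ | _ , _ , refl , sp with above-nil st q uniq
... | refl = up (branching-Spine (SearchTree-left st) q (λ p → uniq (left p)) (up sp))
staggered-Pattern st (branching _ here uniq _ s) h₁ h₂ | _ , _ , refl , sp =
  short-Pattern (below-LeftPath st uniq) (up sp) (h₁ zero refl refl)

-- Embeddings of patterns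

-- Containment with the edge kinds of a staggered pattern filled in; injectivity is recovered from
-- order preservation in `embedding-injective`.
record Embedding (P : Tree (Fin k)) (T : Tree (Fin n)) : Set where
  field
    f       : Fin k → Fin n
    f-left  : ∀ {p i} → LeftChild P p i → LeftChild T (f p) (f i)
    f-right : ∀ {p i} → RightChild P p i → InRightSubtree T (f p) (f i)

module _ {P : Tree (Fin k)} {e : EdgeLabelling P} (st : SearchTree P) (s : Staggered P e)
         {T : Tree (Fin n)} where

  Contains⇒Embedding : Contains T P e → Embedding P T
  Contains⇒Embedding occ = record
    { f       = f
    ; f-left  = λ {p} {i} c → subst (λ κ → LeftRelation κ T (f p) (f i)) (staggered-left st s p i c) (f-left p i c)
    ; f-right = λ {p} {i} c → subst (λ κ → RightRelation κ T (f p) (f i)) (staggered-right st s p i c) (f-right p i c)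
    }
    where open Contains occ

  Embedding⇒Contains : (E : Embedding P T) → (∀ {a b} → Embedding.f E a ≡ Embedding.f E b → a ≡ b) →
    Contains T P e
  Embedding⇒Contains E inj = record
    { f           = f
    ; f-injective = inj
    ; f-left      = λ p i c → subst (λ κ → LeftRelation κ T (f p) (f i)) (sym (staggered-left st s p i c)) (f-left c)
    ; f-right     = λ p i c → subst (λ κ → RightRelation κ T (f p) (f i)) (sym (staggered-right st s p i c)) (f-right c)
    }
    where open Embedding E

InSubtree : Tree A → A → A → Set
InSubtree t p i = ∃₂ λ l r → node l p r ⊑ t × i ∈ᵗ node l p r

InLeftSubtree-trans : {t : Tree (Fin n)} {p c i : Fin n} → SearchTree t →
  InLeftSubtree t p c → InSubtree t c i → InLeftSubtree t p i
InLeftSubtree-trans st (l , r , q , (a , b , q′)) (a′ , b′ , q″ , i∈)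
  with node-unique st (⊑-trans q′ (⊑-trans (left here) q)) q″
... | refl , refl = l , r , q , ∈ᵗ-mono q′ i∈

InRightSubtree-trans : {t : Tree (Fin n)} {p c i : Fin n} → SearchTree t →
  InRightSubtree t p c → InSubtree t c i → InRightSubtree t p i
InRightSubtree-trans st (l , r , q , (a , b , q′)) (a′ , b′ , q″ , i∈)
  with node-unique st (⊑-trans q′ (⊑-trans (right here) q)) q″
... | refl , refl = l , r , q , ∈ᵗ-mono q′ i∈

-- Turns the order of labels into subtree relations, which embeddings preserve. The vertex `c` is
-- where the paths to `i` and `j` separate.
<⇒ancestor : {t : Tree (Fin n)} {i j : Fin n} → SearchTree t → i ∈ᵗ t → j ∈ᵗ t → i Fin.< j →
  InLeftSubtree t j i ⊎ InRightSubtree t i j ⊎ ∃[ c ] InLeftSubtree t c i × InRightSubtree t c j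
<⇒ancestor {t = nil} st (_ , _ , ()) _ _
<⇒ancestor {t = node l x r} st i∈ j∈ i<j with ∈ᵗ-split i∈ | ∈ᵗ-split j∈
... | inj₁ i∈l         | inj₂ (inj₁ refl) = inj₁ (_ , _ , here , i∈l)
... | inj₁ i∈l         | inj₂ (inj₂ j∈r)  = inj₂ (inj₂ (x , (_ , _ , here , i∈l) , (_ , _ , here , j∈r)))
... | inj₂ (inj₁ refl) | inj₂ (inj₂ j∈r)  = inj₂ (inj₁ (_ , _ , here , j∈r))
... | inj₂ (inj₁ refl) | inj₂ (inj₁ refl) = ⊥-elim (Fin.<-irrefl refl i<j)
... | inj₂ (inj₁ refl) | inj₁ j∈l         = ⊥-elim (Fin.<-asym i<j (left< st j∈l))
... | inj₂ (inj₂ i∈r)  | inj₂ (inj₁ refl) = ⊥-elim (Fin.<-asym i<j (right> st i∈r))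
... | inj₂ (inj₂ i∈r)  | inj₁ j∈l         = ⊥-elim (Fin.<-asym i<j (Fin.<-trans (left< st j∈l) (right> st i∈r)))
... | inj₁ i∈l         | inj₁ j∈l with <⇒ancestor (SearchTree-left st) i∈l j∈l i<j
...   | inj₁ (_ , _ , q , h)         = inj₁ (_ , _ , left q , h)
...   | inj₂ (inj₁ (_ , _ , q , h))  = inj₂ (inj₁ (_ , _ , left q , h))
...   | inj₂ (inj₂ (c , (_ , _ , q , h) , (_ , _ , q′ , h′))) =
          inj₂ (inj₂ (c , (_ , _ , left q , h) , (_ , _ , left q′ , h′)))
<⇒ancestor {t = node l x r} st i∈ j∈ i<j | inj₂ (inj₂ i∈r) | inj₂ (inj₂ j∈r)
  with <⇒ancestor (SearchTree-right st) i∈r j∈r i<j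
...   | inj₁ (_ , _ , q , h)         = inj₁ (_ , _ , right q , h)
...   | inj₂ (inj₁ (_ , _ , q , h))  = inj₂ (inj₁ (_ , _ , right q , h))
...   | inj₂ (inj₂ (c , (_ , _ , q , h) , (_ , _ , q′ , h′))) =
          inj₂ (inj₂ (c , (_ , _ , right q , h) , (_ , _ , right q′ , h′)))

LeftChild⇒InLeftSubtree : {t : Tree A} {p i : A} → LeftChild t p i → InLeftSubtree t p i
LeftChild⇒InLeftSubtree (a , b , r , q) = _ , _ , q , root∈ᵗ

module _ {P : Tree (Fin k)} (P∈𝒯 : 𝒯 k P) {T : Tree (Fin n)} (T∈𝒯 : 𝒯 n T) (E : Embedding P T) where
  open Embedding E

  private
    stT : SearchTree T
    stT = proj₁ T∈𝒯

  embedding-subtree : ∀ {l p r i} → node l p r ⊑ P → i ∈ᵗ node l p r → InSubtree T (f p) (f i)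
  embedding-subtree {p = p} q (_ , _ , here) with proj₂ T∈𝒯 (f p)
  ... | l , r , q′ = l , r , q′ , root∈ᵗ
  embedding-subtree {l = node a c b} q (_ , _ , left i⊑)
    with InLeftSubtree-trans stT (LeftChild⇒InLeftSubtree (f-left (_ , _ , _ , q)))
           (embedding-subtree (⊑-trans (left here) q) (_ , _ , i⊑))
  ... | l , r , q′ , i∈ = l , r , q′ , ∈ᵗ-mono (left here) i∈
  embedding-subtree {r = node a c b} q (_ , _ , right i⊑)
    with InRightSubtree-trans stT (f-right (_ , _ , _ , q))
           (embedding-subtree (⊑-trans (right here) q) (_ , _ , i⊑))
  ... | l , r , q′ , i∈ = l , r , q′ , ∈ᵗ-mono (right here) i∈

  embedding-InLeftSubtree : ∀ {p i} → InLeftSubtree P p i → InLeftSubtree T (f p) (f i)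
  embedding-InLeftSubtree (nil , r , q , (_ , _ , ()))
  embedding-InLeftSubtree (node a c b , r , q , i∈) =
    InLeftSubtree-trans stT (LeftChild⇒InLeftSubtree (f-left (_ , _ , _ , q)))
      (embedding-subtree (⊑-trans (left here) q) i∈)

  embedding-InRightSubtree : ∀ {p i} → InRightSubtree P p i → InRightSubtree T (f p) (f i)
  embedding-InRightSubtree (l , nil , q , (_ , _ , ()))
  embedding-InRightSubtree (l , node a c b , q , i∈) =
    InRightSubtree-trans stT (f-right (_ , _ , _ , q)) (embedding-subtree (⊑-trans (right here) q) i∈)

  embedding-mono : ∀ a b → a Fin.< b → f a Fin.< f b
  embedding-mono a b a<b with <⇒ancestor (proj₁ P∈𝒯) (proj₂ P∈𝒯 a) (proj₂ P∈𝒯 b) a<b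
  ... | inj₁ h                   = proj₁ stT _ _ (embedding-InLeftSubtree h)
  ... | inj₂ (inj₁ h)            = proj₂ stT _ _ (embedding-InRightSubtree h)
  ... | inj₂ (inj₂ (c , h , h′)) = Fin.<-trans
          (proj₁ stT _ _ (embedding-InLeftSubtree h)) (proj₂ stT _ _ (embedding-InRightSubtree h′))

  embedding-injective : ∀ {a b} → f a ≡ f b → a ≡ b
  embedding-injective {a} {b} eq with Fin.<-cmp a b
  ... | tri< a<b _ _ = ⊥-elim (Fin.<⇒≢ (embedding-mono a b a<b) eq)
  ... | tri≈ _ a≡b _ = a≡b
  ... | tri> _ _ b<a = ⊥-elim (Fin.<⇒≢ (embedding-mono b a b<a) (sym eq))


  embedding-branch : ∀ {l p r i} → node l p r ⊑ P → i ∈ˡ node l p r →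
    ∃₂ λ l′ r′ → node l′ (f p) r′ ⊑ T × f i ∈ˡ node l′ (f p) r′
  embedding-branch {p = p} q (_ , _ , here) with proj₂ T∈𝒯 (f p)
  ... | l , r , q′ = l , r , q′ , (_ , _ , here)
  embedding-branch {l = node a c b} q (_ , _ , left i⊑)
    with f-left (_ , _ , _ , q) | embedding-branch (⊑-trans (left here) q) (_ , _ , i⊑)
  ... | l , m , r , q₁ | l′ , r′ , q₂ , i∈ with node-unique stT (⊑-trans (left here) q₁) q₂
  ...   | refl , refl = _ , _ , q₁ , ∈ˡ-mono (left here) i∈

  embedding-SameBranch : ∀ {a b} → SameBranch P a b → SameBranch T (f a) (f b)
  embedding-SameBranch (nil , q , (_ , _ , ()) , b∈)
  embedding-SameBranch (node l p r , q , a∈ , b∈) with embedding-branch q a∈ | embedding-branch q b∈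
  ... | _ , _ , q₁ , a∈′ | _ , _ , q₂ , b∈′ with node-unique stT q₁ q₂
  ...   | refl , refl = _ , q₁ , a∈′ , b∈′

-- From tree occurrences to string occurrences

HangsOff : Tree A → A → A → Set
HangsOff t i j = ∃[ c ] SameBranch t i c × InRightSubtree t c j

HangsOff-mono : {s t : Tree A} {i j : A} → s ⊑ t → HangsOff s i j → HangsOff t i j
HangsOff-mono s⊑t (c , h , h′) = c , SameBranch-mono s⊑t h , InRightSubtree-mono s⊑t h′

root-compare : {t : Tree A} {i j : A} → i ∈ˡ t → j ∈ᵗ t → SameBranch t i j ⊎ HangsOff t i j
root-compare i∈t j∈t with ∈ᵗ-branch j∈t
... | inj₁ j∈ˡt                  = inj₁ (_ , here , i∈t , j∈ˡt)
... | inj₂ (l , u , r , q , j∈r) =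
  inj₂ (u , (_ , here , i∈t , (l , r , q)) , (l , r , ⊑ˡ⇒⊑ q , j∈r))

LeftPath-∈ : {t : Tree A} {i : A} → LeftPath t → i ∈ᵗ t → i ∈ˡ t
LeftPath-∈ p i∈t with ∈ᵗ-branch i∈t
... | inj₁ i∈ˡt                  = i∈ˡt
... | inj₂ (l , u , r , q , i∈r) with no-right p q i∈r
  where
  no-right : ∀ {t l r : Tree A} {u i} → LeftPath t → node l u r ⊑ˡ t → ¬ i ∈ᵗ r
  no-right (node p) here     (_ , _ , ())
  no-right (node p) (left q) i∈r = no-right p q i∈r
... | ()

-- An embedding does not see letters, only branches and subtrees. On a spine each inequality of
-- letters has a cause of that kind, namely `HangsOff`. The intermediate vertex in `HangsOff` is
-- essential: `j` may hang from the branch of `i` above or below `i`.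
Spine-compare : {t : Tree A} {i j : A} → Spine t → i ∈ᵗ t → j ∈ᵗ t →
  SameBranch t i j ⊎ HangsOff t i j ⊎ HangsOff t j i
Spine-compare nil (_ , _ , ()) _
Spine-compare (up s) i∈ j∈ with ∈ᵗ-split i∈ | ∈ᵗ-split j∈
... | inj₂ (inj₁ refl) | _ = Sum.map₂ inj₁ (root-compare (_ , _ , here) j∈)
... | _ | inj₂ (inj₁ refl) = Sum.map SameBranch-sym inj₂ (root-compare (_ , _ , here) i∈)
... | inj₁ i∈l | inj₁ j∈l  = Sum.map (SameBranch-mono (left here))
        (Sum.map (HangsOff-mono (left here)) (HangsOff-mono (left here))) (Spine-compare s i∈l j∈l)
... | inj₂ (inj₂ (_ , _ , ())) | _
... | inj₁ _ | inj₂ (inj₂ (_ , _ , ()))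
Spine-compare (branch p s) i∈ j∈ with ∈ᵗ-split i∈ | ∈ᵗ-split j∈
... | inj₂ (inj₁ refl) | _ = Sum.map₂ inj₁ (root-compare (_ , _ , here) j∈)
... | inj₁ i∈l | _ = Sum.map₂ inj₁ (root-compare (∈ˡ-mono (left here) (LeftPath-∈ p i∈l)) j∈)
... | _ | inj₂ (inj₁ refl) = Sum.map SameBranch-sym inj₂ (root-compare (_ , _ , here) i∈)
... | _ | inj₁ j∈l =
  Sum.map SameBranch-sym inj₂ (root-compare (∈ˡ-mono (left here) (LeftPath-∈ p j∈l)) i∈)
... | inj₂ (inj₂ i∈r) | inj₂ (inj₂ j∈r) = Sum.map (SameBranch-mono (right here))
        (Sum.map (HangsOff-mono (right here)) (HangsOff-mono (right here))) (Spine-compare s i∈r j∈r)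

InRightSubtree⇒¬SameBranch : {t : Tree (Fin n)} {i j : Fin n} → SearchTree t →
  InRightSubtree t i j → ¬ SameBranch t i j
InRightSubtree⇒¬SameBranch st (l , r , q , j∈r) K = Fin.<-irrefl refl
  (right> (SearchTree-⊑ q st) (SameBranch-∈ (SameBranch-right st q j∈r (SameBranch-sym K))))

module _ {t : Tree (Fin n)} (t∈𝒯 : 𝒯 n t) where
  private
    open Equivalence
    st : SearchTree t
    st = proj₁ t∈𝒯

  -- If the value at j were smaller, it would already occur before i, outside the right subtree.
  φL-right : ∀ {i j} → InRightSubtree t i j → lookup (φL t) i ℕ.< lookup (φL t) j
  φL-right {i} {j} h@(l , r , q , j∈r) with ℕ.<-cmp (lookup (φL t) i) (lookup (φL t) j)
  ... | tri< lt _ _ = lt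
  ... | tri≈ _ eq _ = ⊥-elim (InRightSubtree⇒¬SameBranch st h (to (φL-kernel t∈𝒯) eq))
  ... | tri> _ _ gt with proj₂ (φL-IsRGS t∈𝒯) i _ (proj₁ (φL-IsRGS t∈𝒯) j) gt
  ...   | j′ , j′<i , eq = ⊥-elim (Fin.<-asym j′<i (right> (SearchTree-⊑ q st)
            (SameBranch-∈ (SameBranch-right st q j∈r (to (φL-kernel t∈𝒯) (sym eq))))))

  φL-HangsOff : ∀ {i j} → HangsOff t i j → lookup (φL t) i ℕ.< lookup (φL t) j
  φL-HangsOff {j = j} (c , K , h) =
    subst (ℕ._< lookup (φL t) j) (sym (from (φL-kernel t∈𝒯) K)) (φL-right h)

module _ {P : Tree (Fin k)} (P∈𝒯 : 𝒯 k P) (sp : Spine P) {T : Tree (Fin n)} (T∈𝒯 : 𝒯 n T) where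

  Embedding⇒StringContains : Embedding P T → StringContains (φL T) (φL P)
  Embedding⇒StringContains E =
    StringContains-mono (φL T) (φL P) f (embedding-mono P∈𝒯 T∈𝒯 E) lt
      (λ a b eq → from (φL-kernel T∈𝒯) (embedding-SameBranch P∈𝒯 T∈𝒯 E (to (φL-kernel P∈𝒯) eq)))
    where
    open Embedding E
    open Equivalence
    lt : ∀ a b → lookup (φL P) a ℕ.< lookup (φL P) b → lookup (φL T) (f a) ℕ.< lookup (φL T) (f b)
    lt a b a<b with Spine-compare sp (proj₂ P∈𝒯 a) (proj₂ P∈𝒯 b)
    ... | inj₁ K                    = ⊥-elim (ℕ.<⇒≢ a<b (from (φL-kernel P∈𝒯) K))
    ... | inj₂ (inj₁ (c , K , h))   = φL-HangsOff T∈𝒯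
            (f c , embedding-SameBranch P∈𝒯 T∈𝒯 E K , embedding-InRightSubtree P∈𝒯 T∈𝒯 E h)
    ... | inj₂ (inj₂ h)             = ⊥-elim (ℕ.<-asym a<b (φL-HangsOff P∈𝒯 h))

-- Alignments of a pattern shape with a tree

data Match {A B : Set} : Tree A → Tree B → Set where
  nil  : ∀ {s} → Match nil s
  -- Left children are matched with left children, whereas the right subtree may be matched at any
  -- subtree `s` of `r′`: this is the difference between contiguous and noncontiguous edges.
  node : ∀ {l x r l′ y r′ s} → Match l l′ → s ⊑ r′ → Match r s → Match (node l x r) (node l′ y r′)

module _ (d : Fin n) where

  -- Defined by search so as to be total on `Fin k`; in a search tree the default `d` is reached
  -- only by labels that do not occur in `t`.
  image : {t : Tree (Fin k)} {s : Tree (Fin n)} → Match t s → Fin k → Fin n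
  image nil i = d
  image (node {x = x} {y = y} ml _ mr) i with Fin.<-cmp i x
  ... | tri< _ _ _ = image ml i
  ... | tri≈ _ _ _ = y
  ... | tri> _ _ _ = image mr i

  module _ {l r : Tree (Fin k)} {x : Fin k} {l′ r′ s : Tree (Fin n)} {y : Fin n}
           (ml : Match l l′) (s⊑r′ : s ⊑ r′) (mr : Match r s) where

    private
      m : Match (node l x r) (node l′ y r′)
      m = node ml s⊑r′ mr

    image-left : ∀ {i} → i Fin.< x → image m i ≡ image ml i
    image-left {i} i<x with Fin.<-cmp i x
    ... | tri< _ _ _   = refl
    ... | tri≈ i≮x _ _ = ⊥-elim (i≮x i<x)
    ... | tri> i≮x _ _ = ⊥-elim (i≮x i<x)

    image-root : image m x ≡ y
    image-root with Fin.<-cmp x x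
    ... | tri< _ x≢x _ = ⊥-elim (x≢x refl)
    ... | tri≈ _ _ _   = refl
    ... | tri> _ x≢x _ = ⊥-elim (x≢x refl)

    image-right : ∀ {i} → x Fin.< i → image m i ≡ image mr i
    image-right {i} x<i with Fin.<-cmp i x
    ... | tri< _ _ x≮i = ⊥-elim (x≮i x<i)
    ... | tri≈ _ _ x≮i = ⊥-elim (x≮i x<i)
    ... | tri> _ _ _   = refl

  image-subroot : {a b : Tree (Fin k)} {i : Fin k} {s : Tree (Fin n)} (m : Match (node a i b) s) →
    ∃₂ λ a′ b′ → s ≡ node a′ (image m i) b′
  image-subroot {i = i} (node ml p mr) = _ , _ , cong (λ y → node _ y _) (sym (image-root {x = i} ml p mr))

  image-LeftChild : {t : Tree (Fin k)} {s : Tree (Fin n)} → SearchTree t → (m : Match t s) →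
    ∀ {p i} → LeftChild t p i → LeftChild s (image m p) (image m i)
  image-LeftChild st (node {x = x} {l′ = l′} {y} {r′} ml q mr) (a , b , _ , here) with image-subroot ml
  ... | a′ , b′ , eq = a′ , b′ , r′ , subst₂ (λ u v → node (node a′ u b′) v r′ ⊑ node l′ y r′)
          (sym (image-left ml q mr (left< st root∈ᵗ))) (sym (image-root {x = x} ml q mr))
          (subst (λ u → node u y r′ ⊑ node l′ y r′) eq here)
  image-LeftChild st (node ml q mr) c@(a , b , r , left p)
    with image-LeftChild (SearchTree-left st) ml (a , b , r , p)
  ... | a′ , b′ , r′ , p′ = a′ , b′ , r′ , subst₂ (λ u v → node (node a′ u b′) v r′ ⊑ _)
          (sym (image-left ml q mr (left< st (_ , _ , ⊑-trans (left here) p))))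
          (sym (image-left ml q mr (left< st (_ , _ , p)))) (left p′)
  image-LeftChild st (node ml q mr) c@(a , b , r , right p)
    with image-LeftChild (SearchTree-right st) mr (a , b , r , p)
  ... | a′ , b′ , r′ , p′ = a′ , b′ , r′ , subst₂ (λ u v → node (node a′ u b′) v r′ ⊑ _)
          (sym (image-right ml q mr (right> st (_ , _ , ⊑-trans (left here) p))))
          (sym (image-right ml q mr (right> st (_ , _ , p)))) (right (⊑-trans p′ q))

  image-RightChild : {t : Tree (Fin k)} {s : Tree (Fin n)} → SearchTree t → (m : Match t s) →
    ∀ {p i} → RightChild t p i → InRightSubtree s (image m p) (image m i)
  image-RightChild st (node {x = x} ml q mr) (_ , a , b , here) with image-subroot mr
  ... | a′ , b′ , eq = subst₂ (InRightSubtree _)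
          (sym (image-root {x = x} ml q mr)) (sym (image-right ml q mr (right> st root∈ᵗ)))
          (_ , _ , here , (a′ , b′ , subst (_⊑ _) eq q))
  image-RightChild st (node ml q mr) (l , a , b , left p) = subst₂ (InRightSubtree _)
    (sym (image-left ml q mr (left< st (_ , _ , p))))
    (sym (image-left ml q mr (left< st (_ , _ , ⊑-trans (right here) p))))
    (InRightSubtree-mono (left here) (image-RightChild (SearchTree-left st) ml (l , a , b , p)))
  image-RightChild st (node ml q mr) (l , a , b , right p) = subst₂ (InRightSubtree _)
    (sym (image-right ml q mr (right> st (_ , _ , p))))
    (sym (image-right ml q mr (right> st (_ , _ , ⊑-trans (right here) p))))
    (InRightSubtree-mono (⊑-trans q (right here)) (image-RightChild (SearchTree-right st) mr (l , a , b , p)))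

LeftChild-mono : {s t : Tree A} {p i : A} → s ⊑ t → LeftChild s p i → LeftChild t p i
LeftChild-mono s⊑t (a , b , r , q) = a , b , r , ⊑-trans q s⊑t

Match⇒Embedding : {l r : Tree (Fin k)} {x : Fin k} {s T : Tree (Fin n)} → SearchTree (node l x r) →
  s ⊑ T → Match (node l x r) s → Embedding (node l x r) T
Match⇒Embedding st s⊑T m@(node {y = y} _ _ _) = record
  { f       = image y m
  ; f-left  = λ c → LeftChild-mono s⊑T (image-LeftChild y st m c)
  ; f-right = λ c → InRightSubtree-mono s⊑T (image-RightChild y st m c)
  }

-- From string occurrences to tree occurrences

-- For a tree in `𝒯 n` this says that the block of `i` has the smaller minimum, hence the smaller
-- letter. Avoiding minima lets the condition pass to subtrees that cut off part of a branch, as in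
-- `right-of-parent`.
Precedes : Tree (Fin n) → Fin n → Fin n → Set
Precedes t i j = ∀ j′ → SameBranch t j j′ → ∃[ i′ ] SameBranch t i i′ × i′ Fin.< j′

Precedes⇒∉ˡ : {t : Tree (Fin n)} {i j : Fin n} → SearchTree t → Precedes t i j → ¬ j ∈ˡ t
Precedes⇒∉ˡ {t = nil} st i≺j (_ , _ , ())
Precedes⇒∉ˡ {t = node l x r} st i≺j j∈t with bottom st
... | b , b∈t , b-min with i≺j b (branch⇒SameBranch j∈t b∈t)
...   | i′ , K , i′<b = ℕ.<⇒≱ i′<b (b-min (SameBranch-∈ K))

-- The descent follows `z`, which never is the root since the block of the root holds the minimum.
-- Once `z` lies to the right of the root `x`, either `q` is at most `x`, and `p` shows that `x` has
-- a left child, or `p` and `q` lie to the right too. The vertex found need not be on the branch of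
-- `p` and `q`.
right-of-parent : {t : Tree (Fin n)} {p q z : Fin n} → SearchTree t → p Fin.< q → q Fin.< z →
  z ∈ᵗ t → SameBranch t p q → Precedes t q z →
  ∃₂ λ l y → ∃[ m ] ∃₂ λ u r → node (node l y m) u r ⊑ t × z ∈ᵗ r
right-of-parent {t = nil} st p<q q<z (_ , _ , ()) K q≺z
right-of-parent {t = node l x r} {p} {q} {z} st p<q q<z z∈t K q≺z with ∈ᵗ-split z∈t
... | inj₂ (inj₁ refl) = ⊥-elim (Precedes⇒∉ˡ st q≺z (_ , _ , here))
... | inj₁ z∈l with right-of-parent (SearchTree-left st) p<q q<z z∈l (SameBranch-left st p∈l q∈l K) q≺z′
  where
  q∈l : q ∈ᵗ l
  q∈l = ∈-left st (SameBranch-∈ K) (Fin.<-trans q<z (left< st z∈l))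
  p∈l : p ∈ᵗ l
  p∈l = ∈-left st (SameBranch-∈ (SameBranch-sym K)) (Fin.<-trans p<q (left< st q∈l))
  q≺z′ : Precedes l q z
  q≺z′ z′ J with q≺z z′ (SameBranch-mono (left here) J)
  ... | q′ , K′ , q′<z′ = q′ , SameBranch-left st q∈l
          (∈-left st (SameBranch-∈ K′) (Fin.<-trans q′<z′ (left< st (SameBranch-∈ J)))) K′ , q′<z′
...   | a , y , b , u , r′ , p′ , z∈r′ = a , y , b , u , r′ , left p′ , z∈r′
right-of-parent {t = node l x r} {p} {q} {z} st p<q q<z z∈t K q≺z | inj₂ (inj₂ z∈r) with q Fin.≤? x
... | yes q≤x with l | ∈-left st (SameBranch-∈ (SameBranch-sym K)) (ℕ.<-≤-trans p<q q≤x)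
...   | nil        | _ , _ , ()
...   | node a y b | _ = a , y , b , x , r , here , z∈r
right-of-parent {t = node l x r} {p} {q} {z} st p<q q<z z∈t K q≺z | inj₂ (inj₂ z∈r) | no q≰x
  with right-of-parent (SearchTree-right st) p<q q<z z∈r
         (SameBranch-sym (SameBranch-right st here q∈r (SameBranch-sym K))) q≺z′
  where
  q∈r : q ∈ᵗ r
  q∈r = ∈-right st (SameBranch-∈ K) (ℕ.≰⇒> q≰x)
  q≺z′ : Precedes r q z
  q≺z′ z′ J with q≺z z′ (SameBranch-mono (right here) J)
  ... | q′ , K′ , q′<z′ = q′ , SameBranch-right st here q∈r K′ , q′<z′
... | a , y , b , u , r′ , p′ , z∈r′ = a , y , b , u , r′ , right p′ , z∈r′

φL-Precedes : {t : Tree (Fin n)} → 𝒯 n t → ∀ {i j} → lookup (φL t) i ℕ.< lookup (φL t) j → Precedes t i j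
φL-Precedes {t = t} t∈𝒯 {i} {j} lt j′ K
  with proj₂ (φL-IsRGS t∈𝒯) j′ _ (proj₁ (φL-IsRGS t∈𝒯) i)
         (subst (lookup (φL t) i ℕ.<_) (from (φL-kernel t∈𝒯) K) lt)
  where open Equivalence
... | i′ , i′<j′ , eq = i′ , Equivalence.to (φL-kernel t∈𝒯) (sym eq) , i′<j′

-- A path without right children can be slid up a left branch: only the number of vertices available
-- below the starting point counts.
LeftPath-Match : {t : Tree A} {s u : Tree B} → LeftPath t → Match t s → s ⊑ˡ u → Match t u
LeftPath-Match nil      _             _        = nil
LeftPath-Match (node p) (node m _ _)  here     = node m here nil
LeftPath-Match (node p) (node m _ _)  (left q) = node (LeftPath-Match p m (⊑ˡ-trans (left here) q)) here nil

module _ {P : Tree (Fin k)} (P∈𝒯 : 𝒯 k P) {T : Tree (Fin n)} (T∈𝒯 : 𝒯 n T)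
         (ι : Fin k → Fin n) (mono : ∀ a b → a Fin.< b → ι a Fin.< ι b)
         (same : ∀ {a b} → SameBranch P a b ⇔ SameBranch T (ι a) (ι b)) where

  private
    open Equivalence
    stP : SearchTree P
    stP = proj₁ P∈𝒯
    stT : SearchTree T
    stT = proj₁ T∈𝒯

    mono-≤ : ∀ a b → a Fin.≤ b → ι a Fin.≤ ι b
    mono-≤ a b a≤b with Fin.<-cmp a b
    ... | tri< a<b _ _  = ℕ.<⇒≤ (mono a b a<b)
    ... | tri≈ _ refl _ = ℕ.≤-refl
    ... | tri> _ _ b<a  = ⊥-elim (ℕ.<⇒≱ b<a a≤b)

  match-LeftPath : ∀ {t W} → LeftPath t → t ⊑ P → W ⊑ T → (∀ {v} → v ∈ˡ t → ι v ∈ˡ W) → Match t W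
  match-LeftPath nil t⊑P W⊑T ∈ˡW = nil
  match-LeftPath (node lp) t⊑P W⊑T ∈ˡW with ∈ˡW (_ , _ , here)
  ... | L , R , q = LeftPath-Match (node lp) (node m here nil) q
    where
    m = match-LeftPath lp (⊑-trans (left here) t⊑P) (⊑-trans (left here) (⊑-trans (⊑ˡ⇒⊑ q) W⊑T))
      (λ v∈ → ∈ˡ-below (SearchTree-⊑ W⊑T stT) q (∈ˡW (∈ˡ-mono (left here) v∈))
        (mono _ _ (left< (SearchTree-⊑ t⊑P stP) (∈ˡ⇒∈ᵗ v∈))))

  mutual
    -- The match is anchored at the vertex `u` of the branch of `W` whose right subtree holds the
    -- next branch. The pattern vertices below the branching vertex slide up to `u`, those above it
    -- slide down, so the match begins at some `S` on the branch of `W` and not necessarily at `W`.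
    match : ∀ {t W} → Spine t → t ⊑ P → W ⊑ T → (∀ {v} → v ∈ᵗ t → ι v ∈ᵗ W) →
      (∀ {v} → v ∈ˡ t → ι v ∈ˡ W) → ∃[ S ] S ⊑ˡ W × Match t S
    match nil t⊑P W⊑T ∈W ∈ˡW = _ , here , nil
    match (up {l} {x} sp) t⊑P W⊑T ∈W ∈ˡW with ∈ˡW (_ , _ , here)
    ... | L , R , q
      with match sp (⊑-trans (left here) t⊑P) (⊑-trans (left here) (⊑-trans (⊑ˡ⇒⊑ q) W⊑T))
             (λ v∈ → ∈-below stW q (∈W (∈ᵗ-mono (left here) v∈)) (ι<ιx v∈))
             (λ v∈ → ∈ˡ-below stW q (∈ˡW (∈ˡ-mono (left here) v∈)) (ι<ιx (∈ˡ⇒∈ᵗ v∈)))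
      where
      stW = SearchTree-⊑ W⊑T stT
      ι<ιx : ∀ {v} → v ∈ᵗ l → ι v Fin.< ι x
      ι<ιx v∈ = mono _ _ (left< (SearchTree-⊑ t⊑P stP) v∈)
    ...   | S , S⊑L , m with ⊑ˡ-parent S⊑L
    -- The parent `y` of `S` replaces `ι x`, which closes any gap. It exists because `S` starts on
    -- the left branch below `ι x`.
    ...     | y , r′ , p = node S y r′ , ⊑ˡ-trans p q , node m here nil
    match {W = W} (branch {l} {x} {a} {j} lp sp) t⊑P W⊑T ∈W ∈ˡW
      with ∈ᵗ-branch (∈W (_ , _ , right here))
    ... | inj₁ ιj∈ˡW = ⊥-elim (InRightSubtree⇒¬SameBranch stP (_ , _ , t⊑P , root∈ᵗ)
            (from same (W , W⊑T , ∈ˡW (_ , _ , here) , ιj∈ˡW)))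
    ... | inj₂ (L , u , R , q , ιj∈R@(_ , _ , ιj⊑R)) =
      let S , S⊑ , m′ = match-at sp (⊑-trans (right here) t⊑P) (⊑-trans ιj⊑R (⊑-trans (right here) N⊑T))
      in node L u R , q , node m (⊑-trans (⊑ˡ⇒⊑ S⊑) ιj⊑R) m′
      where
      stW = SearchTree-⊑ W⊑T stT
      stt = SearchTree-⊑ t⊑P stP
      N⊑T : node L u R ⊑ T
      N⊑T = ⊑-trans (⊑ˡ⇒⊑ q) W⊑T
      -- `u` takes over from `ι x` as branching vertex. From `ι x` < `ι j` it follows that `u` is
      -- not below `ι x`, so the images of `l` remain available under `u`.
      ιx≤u : ι x Fin.≤ u
      ιx≤u = ∈ˡ⇒≤root (SearchTree-⊑ N⊑T stT)
        (∈ˡ-<⇒∈ˡ stW q (∈ᵗ-mono (right here) ιj∈R) (∈ˡW (_ , _ , here)) (mono _ _ (right> stt root∈ᵗ)))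
      m : Match l L
      m = match-LeftPath lp (⊑-trans (left here) t⊑P) (⊑-trans (left here) N⊑T)
        (λ v∈ → ∈ˡ-below stW q (∈ˡW (∈ˡ-mono (left here) v∈))
          (ℕ.<-≤-trans (mono _ _ (left< stt (∈ˡ⇒∈ᵗ v∈))) ιx≤u))

    -- Since j is the largest label of its subtree, everything in that subtree is mapped
    -- between two vertices of the left branch of T starting at ι j.
    match-at : ∀ {a j L R} → Spine (node a j nil) → node a j nil ⊑ P → node L (ι j) R ⊑ T →
      ∃[ S ] S ⊑ˡ node L (ι j) R × Match (node a j nil) S
    match-at {a} {j} {L} {R} sp t⊑P W⊑T = match sp t⊑P W⊑T ∈W ∈ˡW
      where
      stt = SearchTree-⊑ t⊑P stP
      ≤j : ∀ {v} → v ∈ᵗ node a j nil → v Fin.≤ j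
      ≤j v∈ with ∈ᵗ-split v∈
      ... | inj₁ v∈a         = ℕ.<⇒≤ (left< stt v∈a)
      ... | inj₂ (inj₁ refl) = ℕ.≤-refl
      ... | inj₂ (inj₂ (_ , _ , ()))
      ∈ˡW : ∀ {v} → v ∈ˡ node a j nil → ι v ∈ˡ node L (ι j) R
      ∈ˡW v∈ = SameBranch⇒∈ˡ stT W⊑T (to same (_ , t⊑P , (_ , _ , here) , v∈))
        (mono-≤ _ _ (≤j (∈ˡ⇒∈ᵗ v∈)))
      ∈W : ∀ {v} → v ∈ᵗ node a j nil → ι v ∈ᵗ node L (ι j) R
      ∈W v∈ with bottom stt
      ... | b , b∈ , b-min = ⊑-convex stT W⊑T (∈ˡ⇒∈ᵗ (∈ˡW b∈)) root∈ᵗ (proj₂ T∈𝒯 _)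
              (mono-≤ _ _ (b-min v∈)) (mono-≤ _ _ (≤j v∈))

  match-top : (∀ {a b} → InRightSubtree P a b → Precedes T (ι a) (ι b)) → Pattern P →
    ∃[ S ] S ⊑ T × Match P S
  match-top prec (up {x = x} sp) with proj₂ T∈𝒯 (ι x)
  ... | L , R , q with match-at (up sp) here q
  ...   | S , S⊑ , m = S , ⊑-trans (⊑ˡ⇒⊑ S⊑) q , m
  match-top prec (single {x} {a} {j} sp) with ∈ᵗ-branch (proj₂ T∈𝒯 (ι j))
  ... | inj₁ j∈ˡ = ⊥-elim (Precedes⇒∉ˡ stT (prec (_ , _ , here , root∈ᵗ)) j∈ˡ)
  ... | inj₂ (L , u , R , q , (_ , _ , p)) with match-at sp (right here) (⊑-trans p (⊑-trans (right here) (⊑ˡ⇒⊑ q)))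
  ...   | S , S⊑ , m = node L u R , ⊑ˡ⇒⊑ q , node nil (⊑-trans (⊑ˡ⇒⊑ S⊑) p) m
  match-top prec (double {x} {y} {a} {j} sp)
    with right-of-parent stT (mono y x (left< stP root∈ᵗ)) (mono x j (right> stP root∈ᵗ)) (proj₂ T∈𝒯 (ι j))
           (to same (_ , here , (_ , _ , left here) , (_ , _ , here))) (prec (_ , _ , here , root∈ᵗ))
  ... | L , v , M , u , R , q , (_ , _ , p) with match-at sp (right here) (⊑-trans p (⊑-trans (right here) q))
  ...   | S , S⊑ , m = _ , q , node (node nil here nil) (⊑-trans (⊑ˡ⇒⊑ S⊑) p) m

StringContains⇒Embedding : {P : Tree (Fin k)} → 𝒯 k P → Pattern P → {T : Tree (Fin n)} → 𝒯 n T →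
  StringContains (φL T) (φL P) → Embedding P T
StringContains⇒Embedding {P = P} P∈𝒯 pat {T} T∈𝒯 (ι , mono , lt , eq) =
  build pat (match-top P∈𝒯 T∈𝒯 ι mono same
    (λ h → φL-Precedes T∈𝒯 (from (lt _ _) (φL-right P∈𝒯 h))) pat)
  where
  open Equivalence
  same : ∀ {a b} → SameBranch P a b ⇔ SameBranch T (ι a) (ι b)
  same = mk⇔ (λ K → to (φL-kernel T∈𝒯) (from (eq _ _) (from (φL-kernel P∈𝒯) K)))
             (λ K → to (φL-kernel P∈𝒯) (to (eq _ _) (from (φL-kernel T∈𝒯) K)))
  -- The case split only exhibits `P` as a `node`: the root of its match then serves as the default
  -- label in `Match⇒Embedding`.
  build : Pattern P → ∃[ S ] S ⊑ T × Match P S → Embedding P T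
  build (up _)     (_ , p , m) = Match⇒Embedding (proj₁ P∈𝒯) p m
  build (single _) (_ , p , m) = Match⇒Embedding (proj₁ P∈𝒯) p m
  build (double _) (_ , p , m) = Match⇒Embedding (proj₁ P∈𝒯) p m

-- The bijection between avoiders

theorem15 : ∀ {k} (P : Tree (Fin k)) → 𝒯 k P → (e : EdgeLabelling P) (s : Staggered P e) →
    let open Signature (signature s) in
    ((i : Fin ℓ∸1) → toℕ i ≡ 0 → lookup β i ≡ lookup α (inject₁ i) → lookup α (inject₁ i) ≡ 1 ⊎ lookup α (inject₁ i) ≡ 2) →
    ((i : Fin ℓ∸1) → 1 ≤ toℕ i → lookup β i < lookup α (inject₁ i)) →
    ∀ n → BijectionBetween φL (𝒯-avoiding n P e) (𝒫-avoiding n (1 ∷ 2 ∷ 1 ∷ 2 ∷ []) (φL P))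
theorem15 P P∈𝒯 e s h₁ h₂ n = maps , (λ {X} {Y} → injective {X} {Y}) , surjective
  where
  pat : Pattern P
  pat = staggered-Pattern (proj₁ P∈𝒯) s h₁ h₂

  maps : ∀ T → 𝒯-avoiding n P e T → 𝒫-avoiding n 1212-pattern (φL P) (φL T)
  maps T (T∈𝒯 , avoids) = (_ , branches-IsSetPartition T∈𝒯 , refl) , φL-avoids-1212 T∈𝒯 , λ occ →
    let E = StringContains⇒Embedding P∈𝒯 pat T∈𝒯 occ in
    avoids (Embedding⇒Contains (proj₁ P∈𝒯) s E (embedding-injective P∈𝒯 T∈𝒯 E))

  injective : ∀ {X Y : ∃ (𝒯-avoiding n P e)} → φL (proj₁ X) ≡ φL (proj₁ Y) → proj₁ X ≡ proj₁ Y
  injective {_ , T∈𝒯 , _} {_ , T′∈𝒯 , _} = φL-injective T∈𝒯 T′∈𝒯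

  surjective : ∀ (y : ∃ (𝒫-avoiding n 1212-pattern (φL P))) →
    ∃[ X ] (∀ {Z : ∃ (𝒯-avoiding n P e)} → proj₁ Z ≡ proj₁ X → φL (proj₁ Z) ≡ proj₁ y)
  surjective (x , x∈𝒫 , avoids₁ , avoids₂)
    with φL-surjective {x = x} (𝒫⇒IsRGS x∈𝒫) (avoids-1212⇒Noncrossing {x = x} (𝒫⇒IsRGS x∈𝒫) avoids₁)
  ... | T , T∈𝒯 , refl =
    (T , T∈𝒯 , λ occ → avoids₂ (Embedding⇒StringContains P∈𝒯 (Pattern⇒Spine pat) T∈𝒯
                          (Contains⇒Embedding (proj₁ P∈𝒯) s occ))) ,
    cong φL
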